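{- Let $\mathscr{A}=(G,\partial)$ and $\mathscr{A}'=(G,\partial')$ be unicyclizations of a connected graph $G$ such that $\operatorname{im}\partial=\operatorname{im}\partial'$. Let $\beta$ and $\beta'$ be bases of $Z_1(G)$, and let $w_{\mathscr{A}},\lambda_{\mathscr{A}}$ be defined relative to $\beta$ and $w_{\mathscr{A}'},\lambda_{\mathscr{A}'}$ relative to $\beta'$. Then $w_{\mathscr{A}}=\pm w_{\mathscr{A}'}$ (one sign valid for all elements of $Z_1(G)$ simultaneously) and $\lambda_{\mathscr{A}}=\pm\lambda_{\mathscr{A}'}$.
   Context: Graphs are finite and connected; loops and multiple edges are allowed. Fix an orientation of each edge. $\partial_1:\mathbb{Z}^{E(G)}\to\mathbb{Z}^{V(G)}$ is the (oriented) incidence matrix (a loop gives a zero column). $Z_1(G)=\ker\partial_1$ is a free abelian group of rank $m=|E(G)|-|V(G)|+1$; bases are (ordered) $\mathbb{Z}$-bases. A unicyclizer of $G$ is an integer matrix $\partial$ (rows indexed by $E(G)$) with (1) $\ker\partial=0$, (2) $\partial_1\partial=0$, (3) $\operatorname{rk}(\ker\partial_1/\operatorname{im}\partial)=1$. So $\partial$ has $m-1$ linearly independent columns, all in $Z_1(G)$. The pair $\mathscr{A}=(G,\partial)$ is called a unicyclization of $G$; $\operatorname{im}\partial$ is the integral image. For a basis $\beta$ of $Z_1(G)$, $[z]_\beta\in\mathbb{Z}^m$ is the coordinate column vector of $z\in Z_1(G)$, and $[\partial]_\beta$ is the $m\times(m-1)$ matrix whose columns are the coordinate vectors of the columns of $\partial$.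 The winding number map of $\mathscr{A}$ relative to $\beta$ is $w_{\mathscr{A}}:Z_1(G)\to\mathbb{Z}$, $w_{\mathscr{A}}(z)=\det([z]_\beta,[\partial]_\beta)$ (first column $[z]_\beta$). A cycletree of $G$ is a connected spanning subgraph $Y$ of $G$ containing exactly one cycle $C_Y$ (a loop, or a pair of parallel edges, may be that cycle). $\mathcal{U}(G)$ is the set of cycletrees. $z_Y\in Z_1(G)$ is the $\{0,\pm1\}$-vector of $C_Y$ with either orientation chosen. The standard harmonic cycle is $\lambda_{\mathscr{A}}=\sum_{Y\in\mathcal{U}(G)}w_{\mathscr{A}}(z_Y)\cdot z_Y\in Z_1(G)$ (independent of the orientations of the $C_Y$). -}

module Defs where

open import Data.Bool.Properties using () renaming (_≟_ to _≟ᵇ_)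
open import Data.Empty using (⊥-elim) renaming (⊥ to Empty)
open import Data.Fin.Base using (Fin; zero; suc; toℕ; punchIn)
open import Data.Fin.Properties using (_≟_; all?; injective⇒≤)
open import Data.Fin.Subset using (Subset; inside; outside; _∈_; _⊆_; ⊤; ⁅_⁆; ⋃)
open import Data.Fin.Subset.Properties using (_⊆?_; anySubset?)
open import Data.Integer.Base
  using (ℤ; 0ℤ; 1ℤ; -1ℤ; _+_; _*_; _-_; _^_; _◃_)
open import Data.Integer.Properties using (+-*-semiring)
open import Data.List.Base
  using (List; []; _∷_; _++_; [_]; map; foldr; filter; length; lookup; cartesianProduct;
         cartesianProductWith; allFin)
open import Data.List.Membership.Propositional using (find; lose) renaming (_∈_ to _∈ˡ_)
open import Data.List.Membership.Propositional.Properties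
  using (∈-cartesianProductWith⁺; ∈-cartesianProduct⁺; ∈-allFin; ∈-lookup)
open import Data.List.Properties using (length-map)
import Data.List.Relation.Unary.All as All
open import Data.List.Relation.Unary.AllPairs using (_∷_)
open import Data.List.Relation.Unary.Any using (here; there; any?)
open import Data.List.Relation.Unary.Linked using (Linked; linked?)
open import Data.List.Relation.Unary.Unique.Propositional using (Unique)
import Data.List.Relation.Unary.Unique.DecPropositional as UniqueDec
open import Data.Nat.Base using (ℕ; zero; suc; _≤_; s≤s)
open import Data.Nat.Properties using () renaming (≤-trans to ≤ⁿ-trans; ≤-reflexive to ≤ⁿ-reflexive)
open import Data.Product using (_×_; _,_; ∃; ∃!; proj₁; proj₂)
open import Data.Sign.Base using (Sign)
open import Data.Sum using (_⊎_; inj₁; inj₂)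
open import Data.Vec.Base using ([]; _∷_) renaming (here to hereᵛ; there to thereᵛ)
open import Data.Vec.Functional using (Vector)
open import Data.Vec.Properties using (≡-dec)
open import Function.Base using (_∘_)
open import Function.Bundles using (_⇔_)
open import Level using (0ℓ)
open import Relation.Binary.Core using (Rel)
open import Relation.Binary.Definitions using (Decidable)
open import Relation.Binary.Construct.Closure.Equivalence using (EqClosure)
  renaming (map to EqClosure-map)
open import Relation.Binary.Construct.Closure.ReflexiveTransitive using (ε; _◅_; _◅◅_)
open import Relation.Binary.Construct.Closure.Symmetric using (fwd; bwd)
open import Relation.Binary.PropositionalEquality
  using (_≡_; _≢_; _≗_; refl; sym; cong)
open import Relation.Nullary using (Dec; yes; no; ¬?)
open import Relation.Nullary.Decidable using (map′; _×-dec_; _⊎-dec_; decidable-stable)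
import Relation.Unary as U

open import Algebra.Properties.Semiring.Sum +-*-semiring public using (sum; sum-syntax)

Matrix : ℕ → ℕ → Set
Matrix m n = Fin m → Fin n → ℤ

column : ∀ {m n} → Matrix m n → Fin n → Vector ℤ m
column A j i = A i j

_*ᵥ_ : ∀ {m n} → Matrix m n → Vector ℤ n → Vector ℤ m
_*ᵥ_ {n = n} A x i = ∑[ j < n ] (A i j * x j)

𝟎 : ∀ {n} → Vector ℤ n
𝟎 _ = 0ℤ

combination : ∀ {r n} → Vector ℤ r → (Fin r → Vector ℤ n) → Vector ℤ n
combination {r} c x e = ∑[ i < r ] (c i * x i e)

_∈im_ : ∀ {m n} → Vector ℤ m → Matrix m n → Set
y ∈im A = ∃ λ x → y ≗ A *ᵥ x

minor : ∀ {n} → Fin (suc n) → Matrix (suc n) (suc n) → Matrix n n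
minor i A r c = A (punchIn i r) (suc c)

-- Cofactor expansion along the first column.
det : ∀ {n} → Matrix n n → ℤ
det {zero}  A = 1ℤ
det {suc n} A = ∑[ i < suc n ] ((-1ℤ ^ toℕ i) * A i zero * det (minor i A))

record Graph : Set where
  field
    #V #E   : ℕ
    src tgt : Fin #E → Fin #V

δ : ∀ {n} → Fin n → Fin n → ℤ
δ i j with i ≟ j
... | yes _ = 1ℤ
... | no  _ = 0ℤ

module _ (G : Graph) where
  open Graph G

  ∂₁ : Matrix #V #E
  ∂₁ v e = δ (tgt e) v - δ (src e) v

  record Z₁ : Set where
    field
      chain  : Vector ℤ #E
      closed : ∂₁ *ᵥ chain ≗ 𝟎
  open Z₁ public

  record Basis (m : ℕ) : Set where
    field
      element     : Fin m → Z₁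
      independent : ∀ c → combination c (chain ∘ element) ≗ 𝟎 → c ≗ 𝟎
      spanning    : ∀ z → ∃ λ c → chain z ≗ combination c (chain ∘ element)

    coordinates : Z₁ → Vector ℤ m
    coordinates z = proj₁ (spanning z)
  open Basis public

  -- The rank of the abelian group ker ∂₁ / im A is r: there are r elements
  -- linearly independent over ℤ, and any r + 1 elements are dependent.
  QuotientRank : ∀ {k} → Matrix #E k → ℕ → Set
  QuotientRank A r =
      (∃ λ (x : Fin r → Z₁) → ∀ c → combination c (chain ∘ x) ∈im A → c ≗ 𝟎)
    × (∀ (x : Fin (suc r) → Z₁) →
         ∃ λ c → (∃ λ i → c i ≢ 0ℤ) × combination c (chain ∘ x) ∈im A)

  record IsUnicyclizer {k : ℕ} (∂ : Matrix #E k) : Set where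
    field
      ker-trivial : ∀ x → ∂ *ᵥ x ≗ 𝟎 → x ≗ 𝟎
      ∂₁∂≡0       : ∀ j → ∂₁ *ᵥ column ∂ j ≗ 𝟎
      corank-one  : QuotientRank ∂ 1

  record Unicyclization : Set where
    field
      #cols         : ℕ
      ∂             : Matrix #E #cols
      isUnicyclizer : IsUnicyclizer ∂
    open IsUnicyclizer isUnicyclizer public

    ∂-column : Fin #cols → Z₁
    ∂-column j = record { chain = column ∂ j ; closed = ∂₁∂≡0 j }

  -- A unicyclizer has exactly rank Z₁ - 1 columns, so that every basis of Z₁
  -- has suc #cols elements and the matrix below is square.
  winding : (𝒜 : Unicyclization) → Basis (suc (Unicyclization.#cols 𝒜)) → Z₁ → ℤ
  winding 𝒜 β z = det M
    where
    open Unicyclization 𝒜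
    M : Matrix (suc #cols) (suc #cols)
    M i zero    = coordinates β z i
    M i (suc j) = coordinates β (∂-column j) i

  -- A spanning subgraph is given by its set of edges.
  Adjacent : Subset #E → Rel (Fin #V) 0ℓ
  Adjacent Y u v = ∃ λ e → e ∈ Y × src e ≡ u × tgt e ≡ v

  SpanningConnected : Subset #E → Set
  SpanningConnected Y = ∀ u v → EqClosure (Adjacent Y) u v

  Connected : Set
  Connected = SpanningConnected ⊤

  -- Sign.+ means that the edge is travelled from src to tgt.
  Dart : Set
  Dart = Fin #E × Sign

  edge : Dart → Fin #E
  edge = proj₁

  start end : Dart → Fin #V
  start (e , Sign.+) = src e
  start (e , Sign.-) = tgt e
  end   (e , Sign.+) = tgt e
  end   (e , Sign.-) = src e

  -- Cyclic order is expressed by repeating the first dart at the end.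
  Closed : List Dart → Set
  Closed []         = Empty
  Closed ds@(d ∷ _) = Linked (λ x y → end x ≡ start y) (ds ++ [ d ])

  -- Distinctness of the edges excludes going back and forth along one edge.
  IsTraversal : List Dart → Set
  IsTraversal ds = Closed ds × Unique (map start ds) × Unique (map edge ds)

  support : List Dart → Subset #E
  support ds = ⋃ (map (⁅_⁆ ∘ edge) ds)

  IsCycle : Subset #E → Set
  IsCycle C = ∃ λ ds → IsTraversal ds × support ds ≡ C

  traversalVector : List Dart → Vector ℤ #E
  traversalVector []             e = 0ℤ
  traversalVector ((f , s) ∷ ds) e = (s ◃ 1) * δ f e + traversalVector ds e

  -- The direction of the traversal is the choice of orientation of C; as its
  -- edges are distinct, z has entries in {0, ±1}.
  IsCycleVector : Subset #E → Vector ℤ #E → Set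
  IsCycleVector C z =
    ∃ λ ds → IsTraversal ds × support ds ≡ C × z ≗ traversalVector ds

  record IsCycletree (Y : Subset #E) : Set where
    constructor isCycletree
    field
      connected   : SpanningConnected Y
      uniqueCycle : ∃! _≡_ (λ C → IsCycle C × C ⊆ Y)

    theCycle : Subset #E
    theCycle = proj₁ uniqueCycle

private
  module _ {V : Set} {R R′ : Rel V 0ℓ} {a b : V}
           (split : ∀ {u v} → R′ u v → R u v ⊎ (u ≡ a × v ≡ b))
           (R⊆R′ : ∀ {u v} → R u v → R′ u v)
           (new : R′ a b) where

    Via : Rel V 0ℓ
    Via u v = EqClosure R u v
            ⊎ (EqClosure R u a × EqClosure R b v)
            ⊎ (EqClosure R u b × EqClosure R a v)

    fromVia : ∀ {u v} → Via u v → EqClosure R′ u v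
    fromVia (inj₁ p) = EqClosure-map R⊆R′ p
    fromVia (inj₂ (inj₁ (p , q))) =
      EqClosure-map R⊆R′ p ◅◅ fwd new ◅ EqClosure-map R⊆R′ q
    fromVia (inj₂ (inj₂ (p , q))) =
      EqClosure-map R⊆R′ p ◅◅ bwd new ◅ EqClosure-map R⊆R′ q

    prefix : ∀ {u w v} → EqClosure R u w → Via w v → Via u v
    prefix s (inj₁ p)              = inj₁ (s ◅◅ p)
    prefix s (inj₂ (inj₁ (p , q))) = inj₂ (inj₁ (s ◅◅ p , q))
    prefix s (inj₂ (inj₂ (p , q))) = inj₂ (inj₂ (s ◅◅ p , q))

    fromA : ∀ {v} → Via b v → Via a v
    fromA (inj₁ p)              = inj₂ (inj₁ (ε , p))
    fromA (inj₂ (inj₁ (_ , q))) = inj₂ (inj₁ (ε , q))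
    fromA (inj₂ (inj₂ (_ , q))) = inj₁ q

    fromB : ∀ {v} → Via a v → Via b v
    fromB (inj₁ p)              = inj₂ (inj₂ (ε , p))
    fromB (inj₂ (inj₁ (_ , q))) = inj₁ q
    fromB (inj₂ (inj₂ (_ , q))) = inj₂ (inj₂ (ε , q))

    toVia : ∀ {u v} → EqClosure R′ u v → Via u v
    toVia ε = inj₁ ε
    toVia (fwd r ◅ p) with split r
    ... | inj₁ s             = prefix (fwd s ◅ ε) (toVia p)
    ... | inj₂ (refl , refl) = fromA (toVia p)
    toVia (bwd r ◅ p) with split r
    ... | inj₁ s             = prefix (bwd s ◅ ε) (toVia p)
    ... | inj₂ (refl , refl) = fromB (toVia p)

    extend? : Decidable (EqClosure R) → Decidable (EqClosure R′)
    extend? R? u v = map′ fromVia toVia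
      (R? u v ⊎-dec (R? u a ×-dec R? b v) ⊎-dec (R? u b ×-dec R? a v))

  reachable? : ∀ {n k} (s t : Fin k → Fin n) (Y : Subset k) →
    Decidable (EqClosure (λ u v → ∃ λ e → e ∈ Y × s e ≡ u × t e ≡ v))
  reachable? s t [] u v with u ≟ v
  ... | yes refl = yes ε
  ... | no  u≢v  = no λ where
    ε                      → u≢v refl
    (fwd (() , _) ◅ _)
    (bwd (() , _) ◅ _)
  reachable? s t (outside ∷ Y) u v =
    map′ (EqClosure-map λ where (e , e∈Y , p) → suc e , thereᵛ e∈Y , p)
         (EqClosure-map λ where (suc e , thereᵛ e∈Y , p) → e , e∈Y , p)
         (reachable? (s ∘ suc) (t ∘ suc) Y u v)
  reachable? s t (inside ∷ Y) =
    extend? {a = s zero} {b = t zero}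
      (λ where
        (zero  , hereᵛ      , refl , refl) → inj₂ (refl , refl)
        (suc e , thereᵛ e∈Y , p)           → inj₁ (e , e∈Y , p))
      (λ where (e , e∈Y , p) → suc e , thereᵛ e∈Y , p)
      (zero , hereᵛ , refl , refl)
      (reachable? (s ∘ suc) (t ∘ suc) Y)

  ∃!-subset? : ∀ {n} {P : Subset n → Set} → U.Decidable P → Dec (∃! _≡_ P)
  ∃!-subset? P? = anySubset? λ x → P? x ×-dec
    map′ (λ none {y} Py → decidable-stable (≡-dec _≟ᵇ_ x y) λ x≢y → none (y , Py , x≢y))
         (λ all (y , Py , x≢y) → x≢y (all Py))
         (¬? (anySubset? λ y → P? y ×-dec ¬? (≡-dec _≟ᵇ_ x y)))

  listsUpTo : {A : Set} → ℕ → List A → List (List A)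
  listsUpTo zero    as = [ [] ]
  listsUpTo (suc n) as = [] ∷ cartesianProductWith _∷_ as (listsUpTo n as)

  ∈-listsUpTo : {A : Set} {as : List A} → (∀ a → a ∈ˡ as) →
                ∀ n xs → length xs ≤ n → xs ∈ˡ listsUpTo n as
  ∈-listsUpTo complete zero    []       _       = here refl
  ∈-listsUpTo complete (suc n) []       _       = here refl
  ∈-listsUpTo complete (suc n) (x ∷ xs) (s≤s p) =
    there (∈-cartesianProductWith⁺ _∷_ (complete x) (∈-listsUpTo complete n xs p))

  lookup-injective : {A : Set} {xs : List A} → Unique xs →
                     ∀ {i j} → lookup xs i ≡ lookup xs j → i ≡ j
  lookup-injective (_  ∷ _)  {zero}  {zero}  _  = refl
  lookup-injective (x∉ ∷ _)  {zero}  {suc j} eq = ⊥-elim (All.lookup x∉ (∈-lookup j) eq)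
  lookup-injective (x∉ ∷ _)  {suc i} {zero}  eq = ⊥-elim (All.lookup x∉ (∈-lookup i) (sym eq))
  lookup-injective (_  ∷ xs) {suc i} {suc j} eq = cong suc (lookup-injective xs eq)

module _ (G : Graph) where
  open Graph G

  private
    closed? : U.Decidable (Closed G)
    closed? []       = no λ ()
    closed? (d ∷ ds) = linked? (λ x y → end G x ≟ start G y) (d ∷ ds ++ [ d ])

    isTraversal? : U.Decidable (IsTraversal G)
    isTraversal? ds = closed? ds ×-dec UniqueDec.unique? _≟_ (map (start G) ds)
                                 ×-dec UniqueDec.unique? _≟_ (map (edge G) ds)

    darts : List (Dart G)
    darts = cartesianProduct (allFin #E) (Sign.+ ∷ Sign.- ∷ [])

    ∈-darts : ∀ d → d ∈ˡ darts
    ∈-darts (e , Sign.+) = ∈-cartesianProduct⁺ (∈-allFin e) (here refl)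
    ∈-darts (e , Sign.-) = ∈-cartesianProduct⁺ (∈-allFin e) (there (here refl))

    isCycle? : U.Decidable (IsCycle G)
    isCycle? C = map′ to from
      (any? (λ ds → isTraversal? ds ×-dec ≡-dec _≟ᵇ_ (support G ds) C) (listsUpTo #E darts))
      where
      to = λ p → let ds , _ , q = find p in ds , q
      from : IsCycle G C → _
      from (ds , q@((_ , _ , distinct) , _)) =
        lose (∈-listsUpTo ∈-darts #E ds
               (≤ⁿ-trans (≤ⁿ-reflexive (sym (length-map (edge G) ds)))
                         (injective⇒≤ (lookup-injective distinct)))) q

  isCycletree? : U.Decidable (IsCycletree G)
  isCycletree? Y = map′ (λ (p , q) → isCycletree p q) (λ (isCycletree p q) → p , q)
    (all? (λ u → all? λ v → reachable? src tgt Y u v)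
      ×-dec ∃!-subset? λ C → isCycle? C ×-dec C ⊆? Y)

subsets : ∀ n → List (Subset n)
subsets zero    = [ [] ]
subsets (suc n) = map (outside ∷_) (subsets n) ++ map (inside ∷_) (subsets n)

module _ (G : Graph) where
  open Graph G

  cycletrees : List (Subset #E)
  cycletrees = filter (isCycletree? G) (subsets #E)

  -- A choice of z_Y for each cycletree Y, i.e. of an orientation of its cycle.
  -- The value of z on other edge sets is arbitrary and never used.
  record CycleChoice : Set where
    field
      z       : Subset #E → Z₁ G
      z-cycle : ∀ Y (y : IsCycletree G Y) →
                IsCycleVector G (IsCycletree.theCycle y) (chain (z Y))

  harmonicCycle : (𝒜 : Unicyclization G) → Basis G (suc (Unicyclization.#cols 𝒜)) →
                  CycleChoice → Vector ℤ #E
  harmonicCycle 𝒜 β o e =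
    foldr (λ Y acc → winding G 𝒜 β (z Y) * chain (z Y) e + acc) 0ℤ cycletrees
    where open CycleChoice o

SameImage : ∀ {m k k′} → Matrix m k → Matrix m k′ → Set
SameImage A B = ∀ y → y ∈im A ⇔ y ∈im B

{-# OPTIONS --safe #-}
module Submission where

-- A row-multilinear alternating form F on square matrices is F δ times det, hence det is
-- multiplicative.  The bases β and β′ differ by an invertible integer matrix P and the matrices
-- ∂ and ∂′ by an invertible integer matrix Q, so the two winding matrices satisfy
-- M = P M′ (1 ⊕ Q), and det P and det Q are units of ℤ.
--
-- A closed chain supported on a cycle carries the same flow through all darts of a traversal of
-- it, so two vectors of the same cycle agree up to a factor c with c² = 1, and z ↦ w(z) z does not
-- depend on the choice of orientation.

open import Defs
open import Data.Fin.Base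
  using (Fin; zero; suc; toℕ; fromℕ<; inject₁; punchIn; punchOut) renaming (_<_ to _<ᶠ_)
open import Data.Fin.Induction using (<-weakInduction)
open import Data.Fin.Properties
  using (_≟_; any?; toℕ<n; toℕ-fromℕ<; toℕ-injective; toℕ-inject₁; punchInᵢ≢i; punchIn-punchOut;
         punchOut-injective; punchIn-injective; pigeonhole; <-cmp)
open import Data.Fin.Subset using (Subset) renaming (_∈_ to _∈ˢ_)
open import Data.Fin.Subset.Properties using (x∈p∪q⁻; x∈p∪q⁺; x∈⁅x⁆; x∈⁅y⁆⇒x≡y; ∉⊥)
open import Data.Integer.Base
  using (ℤ; 0ℤ; 1ℤ; -1ℤ; _+_; _*_; _-_; -_; _^_; _◃_; ∣_∣)
import Data.Integer.Base as ℤ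
open import Data.Integer.Properties
  using (+-*-semiring; +-identityˡ; +-identityʳ; *-zeroˡ; *-zeroʳ; *-identityˡ; *-identityʳ;
         *-comm; *-assoc; *-distribˡ-+; -1*i≡-i; +-injective; neg-injective; neg-involutive;
         abs-*; i≡j⇒i-j≡0; i-j≡0⇒i≡j; +∣i∣≡i⊎+∣i∣≡-i)
open import Data.Integer.Tactic.RingSolver using (solve-∀)
open import Data.List.Base using (List; []; _∷_; _++_; [_]; map; foldr)
open import Data.List.Membership.DecPropositional using (_∈?_)
open import Data.List.Membership.Propositional using (_∈_; _∉_)
open import Data.List.Relation.Unary.All as All using (All; []; _∷_)
open import Data.List.Relation.Unary.All.Properties using (all-filter)
open import Data.List.Relation.Unary.AllPairs using (_∷_)
open import Data.List.Relation.Unary.Any using (here; there)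
open import Data.List.Relation.Unary.Linked using (Linked; _∷_)
open import Data.List.Relation.Unary.Unique.Propositional using (Unique)
open import Data.Nat.Base using (zero; suc; _≤_; _<_; z≤n; s≤s)
open import Data.Nat.Properties
  using (_<?_; ≤∧≢⇒<; <⇒≢; n<1+n; m*n≡1⇒m≡1; <-irrefl; ≤-<-trans; ≤⇒≯)
open import Data.Product using (∃; _×_; _,_; proj₁; proj₂)
open import Data.Sign.Base using (Sign)
open import Data.Sum using (_⊎_; inj₁; inj₂)
open import Data.Vec.Functional using (Vector; updateAt)
open import Data.Vec.Functional.Properties using (updateAt-updates; updateAt-minimal)
open import Function.Base using (_∘_; const)
open import Function.Bundles using (Equivalence)
open import Relation.Binary.Definitions using (tri<; tri≈; tri>)
open import Relation.Binary.PropositionalEquality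
  using (_≡_; _≢_; _≗_; refl; sym; trans; cong; cong₂; cong-app; subst; ≢-sym; module ≡-Reasoning)
open import Relation.Nullary using (yes; no; contradiction)

open import Algebra.Properties.Semiring.Sum +-*-semiring
  using (sum-cong-≗; ∑-distrib-+; ∑-comm; *-distribˡ-sum; *-distribʳ-sum; sum-replicate-zero)
open ≡-Reasoning

-- Determinants

-- `det` expands along the first column, while the uniqueness argument works with rows; linearity in
-- each row and vanishing on equal rows have to be extracted from that expansion by induction on the
-- size. The column counts of `∂` and `∂′` are unrelated on the level of types, so P and Q start out
-- as rectangular matrices, and their determinants make sense only once a trace count has identified
-- the sizes. The sign is det P · det (1 ⊕ Q); neither factor involves z, hence one sign serves all
-- of Z₁. Two traversals of one cycle may differ in starting point and direction. They are never
-- compared dart by dart: conservation of flow makes each vector an integer multiple of the other,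
-- and an entry ±1 forces the two factors to have product 1.

δ-refl : ∀ {n} (i : Fin n) → δ i i ≡ 1ℤ
δ-refl i with i ≟ i
... | yes _   = refl
... | no  i≢i = contradiction refl i≢i

δ-≢ : ∀ {n} {i j : Fin n} → i ≢ j → δ i j ≡ 0ℤ
δ-≢ {i = i} {j} i≢j with i ≟ j
... | yes i≡j = contradiction i≡j i≢j
... | no  _   = refl

δ-suc : ∀ {n} (i j : Fin n) → δ (suc i) (suc j) ≡ δ i j
δ-suc i j with i ≟ j
... | yes _ = refl
... | no  _ = refl

δ-comm : ∀ {n} (i j : Fin n) → δ i j ≡ δ j i
δ-comm i j with i ≟ j
... | yes refl = sym (δ-refl i)
... | no  i≢j  = sym (δ-≢ (≢-sym i≢j))

sum-zero : ∀ {n} {f : Vector ℤ n} → f ≗ 𝟎 → sum f ≡ 0ℤ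
sum-zero {n} f≗𝟎 = trans (sum-cong-≗ f≗𝟎) (sum-replicate-zero n)

sum-δˡ : ∀ {n} (i : Fin n) (f : Vector ℤ n) → ∑[ j < n ] (δ i j * f j) ≡ f i
sum-δˡ zero    f = begin
  1ℤ * f zero + sum (λ j → 0ℤ * f (suc j))
    ≡⟨ cong₂ _+_ (*-identityˡ (f zero)) (sum-zero λ j → *-zeroˡ (f (suc j))) ⟩
  f zero + 0ℤ                              ≡⟨ +-identityʳ _ ⟩
  f zero                                   ∎
sum-δˡ (suc i) f = begin
  0ℤ * f zero + sum (λ j → δ (suc i) (suc j) * f (suc j))
    ≡⟨ cong₂ _+_ (*-zeroˡ (f zero)) (sum-cong-≗ λ j → cong (_* f (suc j)) (δ-suc i j)) ⟩
  0ℤ + sum (λ j → δ i j * f (suc j))  ≡⟨ +-identityˡ _ ⟩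
  sum (λ j → δ i j * f (suc j))       ≡⟨ sum-δˡ i (f ∘ suc) ⟩
  f (suc i)                           ∎

sum-δʳ : ∀ {n} (f : Vector ℤ n) (i : Fin n) → ∑[ j < n ] (f j * δ j i) ≡ f i
sum-δʳ f i = trans (sum-cong-≗ λ j → trans (*-comm (f j) _) (cong (_* f j) (δ-comm j i))) (sum-δˡ i f)

sum-linear : ∀ {n} s t (f g : Vector ℤ n) → ∑[ i < n ] (s * f i + t * g i) ≡ s * sum f + t * sum g
sum-linear s t f g = trans (∑-distrib-+ (λ i → s * f i) (λ i → t * g i))
                           (sym (cong₂ _+_ (*-distribˡ-sum s f) (*-distribˡ-sum t g)))

-- The shape of a cofactor expansion in which two neighbouring rows agree: their terms cancel, and
-- every other term contains a minor that still has two equal rows.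
sum-pair-zero : ∀ {n} (f : Vector ℤ (suc n)) (i : Fin n) → f (inject₁ i) + f (suc i) ≡ 0ℤ →
                (∀ r → r ≢ inject₁ i → r ≢ suc i → f r ≡ 0ℤ) → sum f ≡ 0ℤ
sum-pair-zero f zero pair rest = begin
  f zero + (f (suc zero) + sum (λ j → f (suc (suc j))))
    ≡⟨ cong (λ x → f zero + (f (suc zero) + x)) (sum-zero λ j → rest (suc (suc j)) (λ ()) (λ ())) ⟩
  f zero + (f (suc zero) + 0ℤ)  ≡⟨ cong (f zero +_) (+-identityʳ _) ⟩
  f zero + f (suc zero)         ≡⟨ pair ⟩
  0ℤ                            ∎
sum-pair-zero f (suc i) pair rest = cong₂ _+_ (rest zero (λ ()) (λ ()))
  (sum-pair-zero (f ∘ suc) i pair λ r p q → rest (suc r) (λ where refl → p refl) (λ where refl → q refl))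

-- Integer matrices and their products

infix 4 _≋_
_≋_ : ∀ {m n} → Matrix m n → Matrix m n → Set
A ≋ B = ∀ i → A i ≗ B i

infixl 7 _⊗_
_⊗_ : ∀ {l m n} → Matrix l m → Matrix m n → Matrix l n
_⊗_ {m = m} A B i j = ∑[ k < m ] (A i k * B k j)

⊗-assoc : ∀ {l m n o} (A : Matrix l m) (B : Matrix m n) (C : Matrix n o) → (A ⊗ B) ⊗ C ≋ A ⊗ (B ⊗ C)
⊗-assoc {m = m} {n} A B C i j = begin
  ∑[ k < n ] (sum (λ h → A i h * B h k) * C k j)
    ≡⟨ sum-cong-≗ (λ k → *-distribʳ-sum (C k j) (λ h → A i h * B h k)) ⟩
  ∑[ k < n ] ∑[ h < m ] (A i h * B h k * C k j)
    ≡⟨ ∑-comm (λ k h → A i h * B h k * C k j) ⟩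
  ∑[ h < m ] ∑[ k < n ] (A i h * B h k * C k j)
    ≡⟨ sum-cong-≗ (λ h → trans (sum-cong-≗ λ k → *-assoc (A i h) (B h k) (C k j))
                               (sym (*-distribˡ-sum (A i h) (λ k → B h k * C k j)))) ⟩
  ∑[ h < m ] (A i h * sum (λ k → B h k * C k j)) ∎

⊗-identityˡ : ∀ {m n} (A : Matrix m n) → δ ⊗ A ≋ A
⊗-identityˡ A i j = sum-δˡ i (λ k → A k j)

⊗-identityʳ : ∀ {m n} (A : Matrix m n) → A ⊗ δ ≋ A
⊗-identityʳ A i j = sum-δʳ (A i) j

sum-one : ∀ n → ∑[ i < n ] 1ℤ ≡ ℤ.+ n
sum-one zero    = refl
sum-one (suc n) = cong (1ℤ +_) (sum-one n)

-- A matrix and its inverse have the same size since tr (A ⊗ B) = tr (B ⊗ A).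
invertible⇒square : ∀ {m n} (A : Matrix m n) (B : Matrix n m) → A ⊗ B ≋ δ → B ⊗ A ≋ δ → m ≡ n
invertible⇒square {m} {n} A B AB≋δ BA≋δ = +-injective (begin
  ℤ.+ m                                 ≡⟨ sum-one m ⟨
  ∑[ i < m ] 1ℤ                         ≡⟨ sum-cong-≗ (λ i → trans (AB≋δ i i) (δ-refl i)) ⟨
  ∑[ i < m ] ∑[ j < n ] (A i j * B j i) ≡⟨ ∑-comm (λ i j → A i j * B j i) ⟩
  ∑[ j < n ] ∑[ i < m ] (A i j * B j i) ≡⟨ sum-cong-≗ (λ j → sum-cong-≗ λ i → *-comm (A i j) (B j i)) ⟩
  ∑[ j < n ] ∑[ i < m ] (B j i * A i j) ≡⟨ sum-cong-≗ (λ j → trans (BA≋δ j j) (δ-refl j)) ⟩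
  ∑[ j < n ] 1ℤ                         ≡⟨ sum-one n ⟩
  ℤ.+ n                                 ∎)

-- Row-multilinear alternating forms

infixl 6 _[_]≔_
_[_]≔_ : ∀ {a} {A : Set a} {n} → Vector A n → Fin n → A → Vector A n
xs [ i ]≔ x = updateAt xs i (const x)

-- Matrices are functions and are compared pointwise, so `F-cong` is a field. Linearity relates
-- three matrices by their rows instead of updating one matrix; this form passes directly to minors
-- and products.
record RowMultilinear {n} (F : Matrix n n → ℤ) : Set where
  field
    F-cong : ∀ {A B} → A ≋ B → F A ≡ F B
    linear : ∀ i {A B C} s t →
             (∀ r → r ≢ i → C r ≗ A r) → (∀ r → r ≢ i → C r ≗ B r) →
             (∀ c → C i c ≡ s * A i c + t * B i c) →
             F C ≡ s * F A + t * F B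

VanishesAt : ∀ {n} → (Matrix n n → ℤ) → Fin n → Fin n → Set
VanishesAt F i j = ∀ A → A i ≗ A j → F A ≡ 0ℤ

Alternating : ∀ {n} → (Matrix n n → ℤ) → Set
Alternating F = ∀ {i j} → i ≢ j → VanishesAt F i j

module _ {n} {F : Matrix n n → ℤ} (multilinear : RowMultilinear F) where
  open RowMultilinear multilinear

  -- F (…a+b…a+b…) = 0 expands to F (…a…b…) + F (…b…a…) = 0.
  swap-rows : ∀ {i j} → i ≢ j → VanishesAt F i j → ∀ {A B} →
              B i ≗ A j → B j ≗ A i → (∀ r → r ≢ i → r ≢ j → B r ≗ A r) → F B ≡ - F A
  swap-rows {i} {j} i≢j vanish {A} {B} Bi Bj Br = begin
    F B                                     ≡⟨ F-cong B≋Dba ⟩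
    F (D b a)                               ≡⟨ solved (F (D a b)) (F (D b a)) ⟩
    (F (D a b) + F (D b a)) - F (D a b)     ≡⟨ cong₂ _-_ total (F-cong (λ r → sym ∘ A≋Dab r)) ⟩
    0ℤ - F A                                ≡⟨ +-identityˡ _ ⟩
    - F A                                   ∎
    where
    a b : Vector ℤ n
    a = A i
    b = A j
    D : Vector ℤ n → Vector ℤ n → Matrix n n
    D u v = (A [ i ]≔ u) [ j ]≔ v
    solved : ∀ x y → y ≡ (x + y) - x
    solved = solve-∀
    Dj : ∀ u v → D u v j ≡ v
    Dj u v = updateAt-updates j (A [ i ]≔ u)
    Di : ∀ u v → D u v i ≡ u
    Di u v = trans (updateAt-minimal i j (A [ i ]≔ u) i≢j) (updateAt-updates i A)
    Dr : ∀ u v r → r ≢ i → r ≢ j → D u v r ≡ A r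
    Dr u v r r≢i r≢j = trans (updateAt-minimal r j (A [ i ]≔ u) r≢j) (updateAt-minimal r i A r≢i)
    characterise : ∀ {C u v} → C i ≗ u → C j ≗ v → (∀ r → r ≢ i → r ≢ j → C r ≗ A r) → C ≋ D u v
    characterise {C} {u} {v} Ci Cj Cr r c with r ≟ i | r ≟ j
    ... | yes refl | _        = trans (Ci c) (sym (cong-app (Di u v) c))
    ... | no _     | yes refl = trans (Cj c) (sym (cong-app (Dj u v) c))
    ... | no r≢i   | no r≢j   = trans (Cr r r≢i r≢j c) (sym (cong-app (Dr u v r r≢i r≢j) c))
    A≋Dab : A ≋ D a b
    A≋Dab = characterise (λ _ → refl) (λ _ → refl) (λ _ _ _ _ → refl)
    B≋Dba : B ≋ D b a
    B≋Dba = characterise Bi Bj Br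
    _⊕_ : Vector ℤ n → Vector ℤ n → Vector ℤ n
    (u ⊕ v) c = u c + v c
    one : ∀ x y {p q} → x ≡ p → y ≡ q → x + y ≡ 1ℤ * p + 1ℤ * q
    one x y refl refl = sym (cong₂ _+_ (*-identityˡ x) (*-identityˡ y))
    additive₁ : ∀ u v w → F (D (u ⊕ v) w) ≡ F (D u w) + F (D v w)
    additive₁ u v w = trans
      (linear i 1ℤ 1ℤ (off u) (off v) (λ c → trans (cong-app (Di (u ⊕ v) w) c)
        (one (u c) (v c) (sym (cong-app (Di u w) c)) (sym (cong-app (Di v w) c)))))
      (sym (one (F (D u w)) (F (D v w)) refl refl))
      where
      off : ∀ x r → r ≢ i → D (u ⊕ v) w r ≗ D x w r
      off x r r≢i with r ≟ j
      ... | yes refl = cong-app (trans (Dj (u ⊕ v) w) (sym (Dj x w)))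
      ... | no  r≢j  = cong-app (trans (Dr (u ⊕ v) w r r≢i r≢j) (sym (Dr x w r r≢i r≢j)))
    additive₂ : ∀ w u v → F (D w (u ⊕ v)) ≡ F (D w u) + F (D w v)
    additive₂ w u v = trans
      (linear j 1ℤ 1ℤ (off u) (off v) (λ c → trans (cong-app (Dj w (u ⊕ v)) c)
        (one (u c) (v c) (sym (cong-app (Dj w u) c)) (sym (cong-app (Dj w v) c)))))
      (sym (one (F (D w u)) (F (D w v)) refl refl))
      where
      off : ∀ x r → r ≢ j → D w (u ⊕ v) r ≗ D w x r
      off x r r≢j with r ≟ i
      ... | yes refl = cong-app (trans (Di w (u ⊕ v)) (sym (Di w x)))
      ... | no  r≢i  = cong-app (trans (Dr w (u ⊕ v) r r≢i r≢j) (sym (Dr w x r r≢i r≢j)))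
    diagonal : ∀ u → F (D u u) ≡ 0ℤ
    diagonal u = vanish (D u u) (cong-app (trans (Di u u) (sym (Dj u u))))
    total : F (D a b) + F (D b a) ≡ 0ℤ
    total = begin
      F (D a b) + F (D b a)
        ≡⟨ cong₂ _+_ (trans (cong (_+ F (D a b)) (diagonal a)) (+-identityˡ (F (D a b))))
                     (trans (cong (F (D b a) +_) (diagonal b)) (+-identityʳ (F (D b a)))) ⟨
      (F (D a a) + F (D a b)) + (F (D b a) + F (D b b))
        ≡⟨ cong₂ _+_ (additive₂ a a b) (additive₂ b a b) ⟨
      F (D a (a ⊕ b)) + F (D b (a ⊕ b))
        ≡⟨ additive₁ a b (a ⊕ b) ⟨
      F (D (a ⊕ b) (a ⊕ b))
        ≡⟨ diagonal (a ⊕ b) ⟩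
      0ℤ ∎

  row-combination-vanishes : ∀ {r} i A (c : Vector ℤ r) (x : Fin r → Vector ℤ n) →
    (∀ k → F (A [ i ]≔ x k) ≡ 0ℤ) → F (A [ i ]≔ combination c x) ≡ 0ℤ
  row-combination-vanishes {r} i A c x zeros = go r c x zeros
    where
    at : ∀ u e → (A [ i ]≔ u) i e ≡ u e
    at u e = cong-app (updateAt-updates i A) e
    off : ∀ u v r → r ≢ i → (A [ i ]≔ u) r ≗ (A [ i ]≔ v) r
    off u v r r≢i e = cong-app (trans (updateAt-minimal r i A r≢i) (sym (updateAt-minimal r i A r≢i))) e
    go : ∀ r (c : Vector ℤ r) x → (∀ k → F (A [ i ]≔ x k) ≡ 0ℤ) → F (A [ i ]≔ combination c x) ≡ 0ℤ
    -- The empty combination is the zero row, that is 0 times row `i` of `A` plus 0 times the same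
    -- row; `A` serves as both summands.
    go zero c x zeros = linear i {A = A} {B = A} 0ℤ 0ℤ
      (λ r r≢i e → cong-app (updateAt-minimal r i A r≢i) e)
      (λ r r≢i e → cong-app (updateAt-minimal r i A r≢i) e)
      (λ e → at (combination c x) e)
    go (suc r) c x zeros = begin
      F (A [ i ]≔ combination c x)
        ≡⟨ linear i (c zero) 1ℤ (off _ _) (off _ _) (λ e → trans (at (combination c x) e)
             (cong₂ _+_ (cong (c zero *_) (sym (at (x zero) e)))
                        (sym (trans (*-identityˡ _) (at (combination (c ∘ suc) (x ∘ suc)) e))))) ⟩
      c zero * F (A [ i ]≔ x zero) + 1ℤ * F (A [ i ]≔ combination (c ∘ suc) (x ∘ suc))
        ≡⟨ cong₂ _+_ (cong (c zero *_) (zeros zero)) (cong (1ℤ *_) (go r (c ∘ suc) (x ∘ suc) (zeros ∘ suc))) ⟩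
      c zero * 0ℤ + 0ℤ
        ≡⟨ trans (+-identityʳ _) (*-zeroʳ (c zero)) ⟩
      0ℤ ∎

module _ {n} {F : Matrix (suc n) (suc n) → ℤ} (multilinear : RowMultilinear F)
         (adjacent : ∀ i → VanishesAt F (inject₁ i) (suc i)) where

  -- Induction on the larger index. If the equal rows are not neighbours, exchanging row `j` with
  -- the next one moves the later copy one place closer to `i`; this costs only a sign, and the
  -- exchange itself needs vanishing at neighbours alone.
  ordered-vanishes : ∀ j i → i <ᶠ j → VanishesAt F i j
  ordered-vanishes = <-weakInduction (λ j → ∀ i → i <ᶠ j → VanishesAt F i j) (λ _ ()) step
    where
    step : ∀ j → (∀ i → i <ᶠ inject₁ j → VanishesAt F i (inject₁ j)) →
           ∀ i → i <ᶠ suc j → VanishesAt F i (suc j)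
    step j IH i (s≤s i≤j) A Ai≗Aj with i ≟ inject₁ j
    ... | yes refl = adjacent j A Ai≗Aj
    ... | no  i≢j  = neg-injective (trans (sym (swap-rows multilinear j≢1+j (adjacent j) {A} {B} Bj B1+j Br))
                       (IH i i<j B λ e → trans (Br i i≢j i≢1+j e) (trans (Ai≗Aj e) (sym (Bj e)))))
      where
      j≢1+j : inject₁ j ≢ suc j
      j≢1+j eq = <⇒≢ (n<1+n (toℕ j)) (trans (sym (toℕ-inject₁ j)) (cong toℕ eq))
      i<j : i <ᶠ inject₁ j
      i<j = subst (toℕ i <_) (sym (toℕ-inject₁ j))
                  (≤∧≢⇒< i≤j λ eq → i≢j (toℕ-injective (trans eq (sym (toℕ-inject₁ j)))))
      i≢1+j : i ≢ suc j
      i≢1+j refl = <-irrefl refl (s≤s i≤j)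
      B : Matrix (suc n) (suc n)
      B = (A [ inject₁ j ]≔ A (suc j)) [ suc j ]≔ A (inject₁ j)
      B1+j : B (suc j) ≗ A (inject₁ j)
      B1+j e = cong-app (updateAt-updates (suc j) (A [ inject₁ j ]≔ A (suc j))) e
      Bj : B (inject₁ j) ≗ A (suc j)
      Bj e = cong-app (trans (updateAt-minimal (inject₁ j) (suc j) (A [ inject₁ j ]≔ A (suc j)) j≢1+j)
                                     (updateAt-updates (inject₁ j) A)) e
      Br : ∀ r → r ≢ inject₁ j → r ≢ suc j → B r ≗ A r
      Br r p q e = cong-app (trans (updateAt-minimal r (suc j) (A [ inject₁ j ]≔ A (suc j)) q)
                                           (updateAt-minimal r (inject₁ j) A p)) e

  adjacent⇒alternating : Alternating F
  adjacent⇒alternating {i} {j} i≢j A Ai≗Aj with <-cmp i j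
  ... | tri< i<j _ _ = ordered-vanishes j i i<j A Ai≗Aj
  ... | tri≈ _ i≡j _ = contradiction i≡j i≢j
  ... | tri> _ _ j<i = ordered-vanishes i j j<i A (sym ∘ Ai≗Aj)

-- Forms that vanish at the identity

module _ {n} {F : Matrix n n → ℤ} (multilinear : RowMultilinear F) (alternating : Alternating F)
         (Fδ≡0 : F δ ≡ 0ℤ) where
  open RowMultilinear multilinear

  private
    module _ (p<n : ∃ λ p → p < n) where
      pivot : Fin n
      pivot = fromℕ< (proj₂ p<n)

      pivot-or-above : ∀ i → proj₁ p<n ≤ toℕ i → i ≢ pivot → suc (proj₁ p<n) ≤ toℕ i
      pivot-or-above i p≤i i≢pivot = ≤∧≢⇒< p≤i λ eq →
        i≢pivot (toℕ-injective (trans (sym eq) (sym (toℕ-fromℕ< (proj₂ p<n)))))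

    -- With the missed value punched out, the map goes into a set with one element fewer, and the
    -- pigeonhole principle applies.
    missed-value : ∀ {n} (σ : Fin n → Fin n) k → (∀ j → σ j ≢ k) → ∃ λ i → ∃ λ j → i ≢ j × σ i ≡ σ j
    missed-value {suc n} σ k missed =
      let i , j , i<j , eq = pigeonhole (n<1+n n) (λ j → punchOut (≢-sym (missed j)))
      in i , j , (λ i≡j → <⇒≢ i<j (cong toℕ i≡j)) ,
         punchOut-injective (≢-sym (missed i)) (≢-sym (missed j)) eq

  -- Selection sort of σ by row swaps, from the last value downwards.
  vanishes-on-unit-rows : ∀ p (σ : Fin n → Fin n) → (∀ i → p ≤ toℕ i → σ i ≡ i) → F (δ ∘ σ) ≡ 0ℤ
  vanishes-on-unit-rows zero σ fixed =
    trans (F-cong λ i j → cong (λ k → δ k j) (fixed i z≤n)) Fδ≡0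
  vanishes-on-unit-rows (suc p) σ fixed with p <? n
  ... | no p≮n = vanishes-on-unit-rows p σ λ i p≤i → contradiction (≤-<-trans p≤i (toℕ<n i)) p≮n
  ... | yes p<n with any? (λ j → σ j ≟ pivot (p , p<n))
  ...   | no missed =
    let i , j , i≢j , σi≡σj = missed-value σ (pivot (p , p<n)) (λ j eq → missed (j , eq))
    in alternating i≢j (δ ∘ σ) λ e → cong (λ k → δ k e) σi≡σj
  ...   | yes (j , σj≡k) with j ≟ pivot (p , p<n)
  ...     | yes refl = vanishes-on-unit-rows p σ fixed′
    where
    fixed′ : ∀ i → p ≤ toℕ i → σ i ≡ i
    fixed′ i p≤i with i ≟ j
    ... | yes refl = σj≡k
    ... | no  i≢j  = fixed i (pivot-or-above (p , p<n) i p≤i i≢j)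
  ...     | no j≢k = neg-injective (trans (sym swapped) (vanishes-on-unit-rows p σ′ fixed′))
    where
    k : Fin n
    k = pivot (p , p<n)
    σ′ : Fin n → Fin n
    σ′ = (σ [ j ]≔ σ k) [ k ]≔ σ j
    σ′k : σ′ k ≡ σ j
    σ′k = updateAt-updates k (σ [ j ]≔ σ k)
    σ′j : σ′ j ≡ σ k
    σ′j = trans (updateAt-minimal j k (σ [ j ]≔ σ k) j≢k) (updateAt-updates j σ)
    σ′r : ∀ r → r ≢ j → r ≢ k → σ′ r ≡ σ r
    σ′r r r≢j r≢k = trans (updateAt-minimal r k (σ [ j ]≔ σ k) r≢k) (updateAt-minimal r j σ r≢j)
    swapped : F (δ ∘ σ′) ≡ - F (δ ∘ σ)
    swapped = swap-rows multilinear j≢k (alternating j≢k)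
      (λ e → cong (λ i → δ i e) σ′j) (λ e → cong (λ i → δ i e) σ′k)
      (λ r r≢j r≢k e → cong (λ i → δ i e) (σ′r r r≢j r≢k))
    fixed′ : ∀ i → p ≤ toℕ i → σ′ i ≡ i
    fixed′ i p≤i with i ≟ k
    ... | yes refl = trans σ′k σj≡k
    ... | no  i≢k  = trans (σ′r i i≢j i≢k) σi≡i
      where
      σi≡i : σ i ≡ i
      σi≡i = fixed i (pivot-or-above (p , p<n) i p≤i i≢k)
      i≢j : i ≢ j
      i≢j refl = j≢k (trans (sym σi≡i) σj≡k)

  -- Multilinear expansion, one row at a time: `p` bounds the rows that are still arbitrary, and the
  -- last of them is expanded in unit vectors with its own entries as coefficients.
  vanishes-above : ∀ p A → (∀ i → p ≤ toℕ i → ∃ λ s → A i ≗ δ s) → F A ≡ 0ℤ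
  vanishes-above zero A units =
    trans (F-cong λ i → proj₂ (units i z≤n))
          -- Sorting starts at `n`, where no value is required to be in place yet.
          (vanishes-on-unit-rows n (λ i → proj₁ (units i z≤n)) λ i n≤i → contradiction (toℕ<n i) (≤⇒≯ n≤i))
  vanishes-above (suc p) A units with p <? n
  ... | no p≮n = vanishes-above p A λ i p≤i → contradiction (≤-<-trans p≤i (toℕ<n i)) p≮n
  ... | yes p<n = trans (F-cong expand)
    (row-combination-vanishes multilinear k A (A k) δ λ s → vanishes-above p (A [ k ]≔ δ s) (units′ s))
    where
    k : Fin n
    k = pivot (p , p<n)
    expand : A ≋ A [ k ]≔ combination (A k) δ
    expand i e with i ≟ k
    ... | yes refl = sym (trans (cong-app (updateAt-updates k A) e) (sum-δʳ (A k) e))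
    ... | no  i≢k  = sym (cong-app (updateAt-minimal i k A i≢k) e)
    units′ : ∀ s i → p ≤ toℕ i → ∃ λ t → (A [ k ]≔ δ s) i ≗ δ t
    units′ s i p≤i with i ≟ k
    ... | yes refl = s , λ e → cong-app (updateAt-updates k A) e
    ... | no  i≢k  =
      let t , eq = units i (pivot-or-above (p , p<n) i p≤i i≢k)
      in t , λ e → trans (cong-app (updateAt-minimal i k A i≢k) e) (eq e)

  form-vanishes : ∀ A → F A ≡ 0ℤ
  form-vanishes A = vanishes-above n A λ i n≤i → contradiction (toℕ<n i) (≤⇒≯ n≤i)

-- The determinant as an alternating form

det-cong : ∀ {n} {A B : Matrix n n} → A ≋ B → det A ≡ det B
det-cong {zero}  p = refl
det-cong {suc n} p = sum-cong-≗ λ i →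
  cong₂ (λ x y → (-1ℤ ^ toℕ i) * x * y) (p i zero) (det-cong λ r c → p (punchIn i r) (suc c))

-- In the term of row `i` the entry is linear and the minor is common to all three matrices. In
-- every other term the entry is common, and the minor is linear by induction, with row `i` now at
-- `punchOut r≢i`.
det-linear : ∀ {n} i {A B C : Matrix n n} s t →
             (∀ r → r ≢ i → C r ≗ A r) → (∀ r → r ≢ i → C r ≗ B r) →
             (∀ c → C i c ≡ s * A i c + t * B i c) →
             det C ≡ s * det A + t * det B
det-linear {suc n} i {A} {B} {C} s t C≗A C≗B Ci =
  trans (sum-cong-≗ term≡) (sum-linear s t (term A) (term B))
  where
  term : Matrix (suc n) (suc n) → Fin (suc n) → ℤ
  term M r = (-1ℤ ^ toℕ r) * M r zero * det (minor r M)
  entry-linear : ∀ g a b d → g * (s * a + t * b) * d ≡ s * (g * a * d) + t * (g * b * d)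
  entry-linear = solved s t
    where
    solved : ∀ s t g a b d → g * (s * a + t * b) * d ≡ s * (g * a * d) + t * (g * b * d)
    solved = solve-∀
  minor-linear : ∀ g a d e → g * a * (s * d + t * e) ≡ s * (g * a * d) + t * (g * a * e)
  minor-linear = solved s t
    where
    solved : ∀ s t g a d e → g * a * (s * d + t * e) ≡ s * (g * a * d) + t * (g * a * e)
    solved = solve-∀
  term≡ : ∀ r → term C r ≡ s * term A r + t * term B r
  term≡ r with r ≟ i
  ... | yes refl = begin
    g * C r zero * det (minor r C)
      ≡⟨ cong (λ x → g * x * det (minor r C)) (Ci zero) ⟩
    g * (s * A r zero + t * B r zero) * det (minor r C)
      ≡⟨ entry-linear g (A r zero) (B r zero) _ ⟩
    s * (g * A r zero * det (minor r C)) + t * (g * B r zero * det (minor r C))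
      ≡⟨ cong₂ (λ x y → s * (g * A r zero * x) + t * (g * B r zero * y))
               (det-cong λ k c → C≗A (punchIn r k) (punchInᵢ≢i r k) (suc c))
               (det-cong λ k c → C≗B (punchIn r k) (punchInᵢ≢i r k) (suc c)) ⟩
    s * term A r + t * term B r ∎
    where
    g : ℤ
    g = -1ℤ ^ toℕ r
  ... | no r≢i = begin
    g * C r zero * det (minor r C)
      ≡⟨ cong (g * C r zero *_) (det-linear (punchOut r≢i) {minor r A} {minor r B} {minor r C} s t
           (λ k k≢ c → C≗A (punchIn r k) (avoids k≢) (suc c))
           (λ k k≢ c → C≗B (punchIn r k) (avoids k≢) (suc c))
           (λ c → subst (λ h → C h (suc c) ≡ s * A h (suc c) + t * B h (suc c))
                        (sym (punchIn-punchOut r≢i)) (Ci (suc c)))) ⟩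
    g * C r zero * (s * det (minor r A) + t * det (minor r B))
      ≡⟨ minor-linear g (C r zero) _ _ ⟩
    s * (g * C r zero * det (minor r A)) + t * (g * C r zero * det (minor r B))
      ≡⟨ cong₂ (λ x y → s * (g * x * det (minor r A)) + t * (g * y * det (minor r B)))
               (C≗A r r≢i zero) (C≗B r r≢i zero) ⟩
    s * term A r + t * term B r ∎
    where
    g : ℤ
    g = -1ℤ ^ toℕ r
    avoids : ∀ {k} → k ≢ punchOut r≢i → punchIn r k ≢ i
    avoids k≢ eq = k≢ (punchIn-injective r _ _ (trans eq (sym (punchIn-punchOut r≢i))))

det-multilinear : ∀ {n} → RowMultilinear (det {n})
det-multilinear = record { F-cong = det-cong ; linear = det-linear }

-- Serves to identify the minors at two equal neighbouring rows: the two lists of remaining rows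
-- differ only at the place where each keeps the neighbour that the other deletes.
punchIn-adjacent : ∀ {n} (i : Fin n) (r : Fin n) →
  punchIn (inject₁ i) r ≡ punchIn (suc i) r ⊎ (punchIn (inject₁ i) r ≡ suc i × punchIn (suc i) r ≡ inject₁ i)
punchIn-adjacent zero    zero    = inj₂ (refl , refl)
punchIn-adjacent zero    (suc r) = inj₁ refl
punchIn-adjacent (suc i) zero    = inj₁ refl
punchIn-adjacent (suc i) (suc r) with punchIn-adjacent i r
... | inj₁ eq       = inj₁ (cong suc eq)
... | inj₂ (p , q)  = inj₂ (cong suc p , cong suc q)

-- A third row cannot lie between two neighbours, so deleting it keeps them side by side and the
-- induction on the size applies to the minor.
punchIn-preserves-adjacency : ∀ {n} (r : Fin (suc (suc n))) (i : Fin (suc n)) → r ≢ inject₁ i → r ≢ suc i →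
  ∃ λ (k : Fin n) → punchIn r (inject₁ k) ≡ inject₁ i × punchIn r (suc k) ≡ suc i
punchIn-preserves-adjacency zero          zero    p q = contradiction refl p
punchIn-preserves-adjacency zero          (suc i) p q = i , refl , refl
punchIn-preserves-adjacency (suc zero)    zero    p q = contradiction refl q
punchIn-preserves-adjacency {suc n} (suc (suc r)) zero p q = zero , refl , refl
punchIn-preserves-adjacency {suc n} (suc r) (suc i) p q =
  let k , eq₁ , eq₂ = punchIn-preserves-adjacency r i (p ∘ cong suc) (q ∘ cong suc)
  in suc k , cong suc eq₁ , cong suc eq₂

det-adjacent : ∀ {n} (i : Fin n) → VanishesAt (det {suc n}) (inject₁ i) (suc i)
det-adjacent {suc n} i A eq = sum-pair-zero term i pair rest
  where
  term : Fin (suc (suc n)) → ℤ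
  term r = (-1ℤ ^ toℕ r) * A r zero * det (minor r A)
  opposite : ∀ g a d → g * a * d + -1ℤ * g * a * d ≡ 0ℤ
  opposite = solve-∀
  minors : minor (suc i) A ≋ minor (inject₁ i) A
  minors r c with punchIn-adjacent i r
  ... | inj₁ p       = cong (λ h → A h (suc c)) (sym p)
  ... | inj₂ (p , q) = trans (cong (λ h → A h (suc c)) q)
                             (trans (eq (suc c)) (cong (λ h → A h (suc c)) (sym p)))
  pair : term (inject₁ i) + term (suc i) ≡ 0ℤ
  -- `toℕ-inject₁` aligns the exponents; the sign at `suc i` then unfolds to `-1ℤ` times the sign at
  -- `inject₁ i`.
  pair = trans (cong₂ _+_ (cong₂ (λ k a → (-1ℤ ^ k) * a * det (minor (inject₁ i) A)) (toℕ-inject₁ i) (eq zero))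
                          (cong (λ d → (-1ℤ ^ toℕ (suc i)) * A (suc i) zero * d) (det-cong minors)))
               (opposite (-1ℤ ^ toℕ i) (A (suc i) zero) (det (minor (inject₁ i) A)))
  rest : ∀ r → r ≢ inject₁ i → r ≢ suc i → term r ≡ 0ℤ
  rest r p q =
    let k , e₁ , e₂ = punchIn-preserves-adjacency r i p q
    in trans (cong ((-1ℤ ^ toℕ r) * A r zero *_)
               (det-adjacent k (minor r A) λ c →
                  trans (cong (λ h → A h (suc c)) e₁) (trans (eq (suc c)) (cong (λ h → A h (suc c)) (sym e₂)))))
             (*-zeroʳ ((-1ℤ ^ toℕ r) * A r zero))

det-alternating : ∀ {n} → Alternating (det {n})
det-alternating {suc n} = adjacent⇒alternating det-multilinear det-adjacent

det-unit-column : ∀ {n} (A : Matrix (suc n) (suc n)) → A zero zero ≡ 1ℤ → (∀ i → A (suc i) zero ≡ 0ℤ) →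
                  det A ≡ det (minor zero A)
det-unit-column A one zeros = begin
  1ℤ * A zero zero * det (minor zero A)
    + sum (λ i → (-1ℤ ^ toℕ (suc i)) * A (suc i) zero * det (minor (suc i) A))
      ≡⟨ cong₂ _+_ (cong (λ x → 1ℤ * x * det (minor zero A)) one) (sum-zero λ i →
         trans (cong (λ x → (-1ℤ ^ toℕ (suc i)) * x * det (minor (suc i) A)) (zeros i))
               (vanish (-1ℤ ^ toℕ (suc i)) _)) ⟩
  1ℤ * det (minor zero A) + 0ℤ  ≡⟨ trans (+-identityʳ _) (*-identityˡ _) ⟩
  det (minor zero A)            ∎
  where
  vanish : ∀ g d → g * 0ℤ * d ≡ 0ℤ
  vanish = solve-∀

det-δ : ∀ n → det {n} δ ≡ 1ℤ
det-δ zero    = refl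
det-δ (suc n) = trans (det-unit-column (δ {suc n}) refl (λ _ → refl))
                      (trans (det-cong {n} δ-suc) (det-δ n))

-- The difference `G` of the two sides is again multilinear and alternating, and it vanishes at `δ`
-- because `det δ` is 1.
multilinear⇒≡det : ∀ {n} {F : Matrix n n → ℤ} → RowMultilinear F → Alternating F →
                   ∀ A → F A ≡ F δ * det A
multilinear⇒≡det {n} {F} F-mult F-alt A =
  i-j≡0⇒i≡j (F A) (F δ * det A) (form-vanishes G-mult G-alt Gδ≡0 A)
  where
  module F = RowMultilinear F-mult
  module D = RowMultilinear (det-multilinear {n})
  G : Matrix n n → ℤ
  G B = F B - F δ * det B
  rearrange : ∀ s t a b a′ b′ d → (s * a + t * b) - d * (s * a′ + t * b′) ≡ s * (a - d * a′) + t * (b - d * b′)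
  rearrange = solve-∀
  G-mult : RowMultilinear G
  G-mult = record
    { F-cong = λ p → cong₂ (λ x y → x - F δ * y) (F.F-cong p) (D.F-cong p)
    ; linear = λ i {B} {C} s t p q r → trans
        (cong₂ (λ x y → x - F δ * y) (F.linear i s t p q r) (D.linear i s t p q r))
        (rearrange s t (F B) (F C) (det B) (det C) (F δ))
    }
  G-alt : Alternating G
  G-alt i≢j B eq = trans (cong₂ (λ x y → x - F δ * y) (F-alt i≢j B eq) (det-alternating i≢j B eq))
                         (cong (λ x → 0ℤ - x) (*-zeroʳ (F δ)))
  Gδ≡0 : G δ ≡ 0ℤ
  Gδ≡0 = trans (cong (λ x → F δ - F δ * x) (det-δ n)) (i≡j⇒i-j≡0 (sym (*-identityʳ (F δ))))

-- Each row of `M ⊗ B` depends linearly on the same row of `M` alone, so for fixed `B` the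
-- determinant of the product is an alternating form in `M` with value `det B` at `δ`.
det-⊗ : ∀ {n} (A B : Matrix n n) → det (A ⊗ B) ≡ det A * det B
det-⊗ {n} A B = begin
  det (A ⊗ B)          ≡⟨ multilinear⇒≡det {F = F} F-mult F-alt A ⟩
  det (δ ⊗ B) * det A  ≡⟨ cong (_* det A) (det-cong (⊗-identityˡ B)) ⟩
  det B * det A        ≡⟨ *-comm (det B) (det A) ⟩
  det A * det B        ∎
  where
  F : Matrix n n → ℤ
  F M = det (M ⊗ B)
  same-row : ∀ {u v : Vector ℤ n} → u ≗ v → ∀ e → sum (λ h → u h * B h e) ≡ sum (λ h → v h * B h e)
  same-row p e = sum-cong-≗ λ h → cong (_* B h e) (p h)
  expand : ∀ s t a b d → (s * a + t * b) * d ≡ s * (a * d) + t * (b * d)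
  expand = solve-∀
  F-mult : RowMultilinear F
  F-mult = record
    { F-cong = λ p → det-cong (λ i → same-row (p i))
    ; linear = λ i {M} {N} s t p q r → det-linear i s t
        (λ k k≢i → same-row (p k k≢i)) (λ k k≢i → same-row (q k k≢i))
        (λ c → trans (sum-cong-≗ λ h → trans (cong (_* B h c) (r h)) (expand s t (M i h) (N i h) (B h c)))
                     (sum-linear s t (λ h → M i h * B h c) (λ h → N i h * B h c)))
    }
  F-alt : Alternating F
  F-alt i≢j M eq = det-alternating i≢j (M ⊗ B) (same-row eq)

-- Units and invertible matrices

IsUnit : ℤ → Set
IsUnit i = i ≡ 1ℤ ⊎ i ≡ -1ℤ

i*j≡1⇒unit : ∀ i j → i * j ≡ 1ℤ → IsUnit i
i*j≡1⇒unit i j eq with m*n≡1⇒m≡1 ∣ i ∣ ∣ j ∣ (trans (sym (abs-* i j)) (cong ∣_∣ eq)) | +∣i∣≡i⊎+∣i∣≡-i i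
... | ∣i∣≡1 | inj₁ p = inj₁ (trans (sym p) (cong ℤ.+_ ∣i∣≡1))
... | ∣i∣≡1 | inj₂ p = inj₂ (trans (sym (neg-involutive i)) (cong -_ (trans (sym p) (cong ℤ.+_ ∣i∣≡1))))

invertible⇒det-unit : ∀ {n} (A B : Matrix n n) → A ⊗ B ≋ δ → IsUnit (det A)
invertible⇒det-unit {n} A B AB≋δ =
  i*j≡1⇒unit (det A) (det B) (trans (sym (det-⊗ A B)) (trans (det-cong AB≋δ) (det-δ n)))

unit-* : ∀ {i j} → IsUnit i → IsUnit j → IsUnit (i * j)
unit-* (inj₁ refl) (inj₁ refl) = inj₁ refl
unit-* (inj₁ refl) (inj₂ refl) = inj₂ refl
unit-* (inj₂ refl) (inj₁ refl) = inj₂ refl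
unit-* (inj₂ refl) (inj₂ refl) = inj₁ refl

-- As a right factor of a winding matrix, it leaves the coordinate column of the cycle alone and
-- recombines only the columns that come from the unicyclizer.
1⊕_ : ∀ {m n} → Matrix m n → Matrix (suc m) (suc n)
(1⊕ A) zero    j       = δ zero j
(1⊕ A) (suc i) zero    = 0ℤ
(1⊕ A) (suc i) (suc j) = A i j

1⊕-⊗-inverse : ∀ {m n} (A : Matrix m n) (B : Matrix n m) → A ⊗ B ≋ δ → (1⊕ A) ⊗ (1⊕ B) ≋ δ
1⊕-⊗-inverse A B AB≋δ zero    j       = sum-δˡ zero (λ k → (1⊕ B) k j)
1⊕-⊗-inverse A B AB≋δ (suc i) zero    = sum-zero {f = λ k → (1⊕ A) (suc i) k * (1⊕ B) k zero} λ where
  zero    → refl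
  (suc k) → *-zeroʳ (A i k)
1⊕-⊗-inverse A B AB≋δ (suc i) (suc j) = trans (+-identityˡ _) (trans (AB≋δ i j) (sym (δ-suc i j)))

-- Invertibility of `P` identifies `m` with `n`, and only then do `P` and `S` have determinants. The
-- sign is produced before `A` and `B` are given, which makes it independent of the cycle.
det-sandwich : ∀ {m n} (P : Matrix m n) (P′ : Matrix n m) (S : Matrix n m) (S′ : Matrix m n) →
  P ⊗ P′ ≋ δ → P′ ⊗ P ≋ δ → S ⊗ S′ ≋ δ →
  ∃ λ s → IsUnit s × (∀ (A : Matrix m m) (B : Matrix n n) → A ≋ P ⊗ B ⊗ S → det A ≡ s * det B)
det-sandwich P P′ S S′ PP′ P′P SS′ with invertible⇒square P P′ PP′ P′P
... | refl = det P * det S ,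
  unit-* (invertible⇒det-unit P P′ PP′) (invertible⇒det-unit S S′ SS′) , λ A B A≋PBS → begin
  det A                  ≡⟨ det-cong A≋PBS ⟩
  det (P ⊗ B ⊗ S)        ≡⟨ trans (det-⊗ (P ⊗ B) S) (cong (_* det S) (det-⊗ P B)) ⟩
  det P * det B * det S  ≡⟨ rearrange (det P) (det B) (det S) ⟩
  det P * det S * det B  ∎
  where
  rearrange : ∀ x y z → x * y * z ≡ x * z * y
  rearrange = solve-∀

-- Each column of `B` is the image of a unit vector; its chosen preimage under `A` becomes a column
-- of `Q`.
im-factor : ∀ {m k l} (A : Matrix m k) (B : Matrix m l) → (∀ y → y ∈im B → y ∈im A) → ∃ λ Q → B ≋ A ⊗ Q
im-factor A B imB⊆imA = (λ h j → proj₁ (preimage j) h) , λ i j → proj₂ (preimage j) i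
  where
  preimage : ∀ j → column B j ∈im A
  preimage j = imB⊆imA (column B j) ((λ k → δ k j) , λ i → sym (sum-δʳ (B i) j))

injective⇒cancelˡ : ∀ {m k l} (A : Matrix m k) → (∀ x → A *ᵥ x ≗ 𝟎 → x ≗ 𝟎) →
                    ∀ (B C : Matrix k l) → A ⊗ B ≋ A ⊗ C → B ≋ C
injective⇒cancelˡ {k = k} A ker-trivial B C AB≋AC i j =
  i-j≡0⇒i≡j (B i j) (C i j) (ker-trivial (λ h → B h j - C h j) difference i)
  where
  distrib : ∀ a b c → a * (b - c) ≡ 1ℤ * (a * b) + -1ℤ * (a * c)
  distrib = solve-∀
  cancel : ∀ x → 1ℤ * x + -1ℤ * x ≡ 0ℤ
  cancel = solve-∀
  difference : A *ᵥ (λ h → B h j - C h j) ≗ 𝟎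
  difference e = begin
    ∑[ h < k ] (A e h * (B h j - C h j))   ≡⟨ sum-cong-≗ (λ h → distrib (A e h) (B h j) (C h j)) ⟩
    ∑[ h < k ] (1ℤ * (A e h * B h j) + -1ℤ * (A e h * C h j))
      ≡⟨ sum-linear 1ℤ -1ℤ (λ h → A e h * B h j) (λ h → A e h * C h j) ⟩
    1ℤ * (A ⊗ B) e j + -1ℤ * (A ⊗ C) e j   ≡⟨ cong (λ x → 1ℤ * x + -1ℤ * (A ⊗ C) e j) (AB≋AC e j) ⟩
    1ℤ * (A ⊗ C) e j + -1ℤ * (A ⊗ C) e j   ≡⟨ cancel ((A ⊗ C) e j) ⟩
    0ℤ                                     ∎

-- Each matrix factors through the other, `B` as `A ⊗ Q` and `A` as `B ⊗ R`; hence `A ⊗ (Q ⊗ R)` is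
-- `A`, and the injective `A` cancels.
same-image⇒invertible : ∀ {m k l} (A : Matrix m k) (B : Matrix m l) →
  (∀ x → A *ᵥ x ≗ 𝟎 → x ≗ 𝟎) → (∀ y → y ∈im A → y ∈im B) → (∀ y → y ∈im B → y ∈im A) →
  ∃ λ Q → ∃ λ R → B ≋ A ⊗ Q × Q ⊗ R ≋ δ
same-image⇒invertible A B ker-trivial imA⊆imB imB⊆imA =
  let Q , B≋AQ = im-factor A B imB⊆imA
      R , A≋BR = im-factor B A imA⊆imB
  in Q , R , B≋AQ , injective⇒cancelˡ A ker-trivial (Q ⊗ R) δ λ i j → begin
       (A ⊗ (Q ⊗ R)) i j  ≡⟨ ⊗-assoc A Q R i j ⟨
       (A ⊗ Q ⊗ R) i j    ≡⟨ sum-cong-≗ (λ h → cong (_* R h j) (B≋AQ i h)) ⟨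
       (B ⊗ R) i j        ≡⟨ A≋BR i j ⟨
       A i j              ≡⟨ ⊗-identityʳ A i j ⟨
       (A ⊗ δ) i j        ∎

-- Winding numbers

module _ {G : Graph} {m} (β : Basis G m) where

  -- `coordinates` is whatever witness `spanning` carries. Independence makes it canonical, so it
  -- may be computed by exhibiting any suitable combination, and it depends on the values of the
  -- chain only.
  coordinates-unique : ∀ z c → chain z ≗ combination c (chain ∘ element β) → coordinates β z ≗ c
  coordinates-unique z c z≗c i =
    i-j≡0⇒i≡j (coordinates β z i) (c i) (independent β (λ k → coordinates β z k - c k) difference i)
    where
    distrib : ∀ x y b → (x - y) * b ≡ 1ℤ * (x * b) + -1ℤ * (y * b)
    distrib = solve-∀
    cancel : ∀ x → 1ℤ * x + -1ℤ * x ≡ 0ℤ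
    cancel = solve-∀
    difference : combination (λ k → coordinates β z k - c k) (chain ∘ element β) ≗ 𝟎
    difference e = begin
      combination (λ k → coordinates β z k - c k) (chain ∘ element β) e
        ≡⟨ sum-cong-≗ (λ k → distrib (coordinates β z k) (c k) (chain (element β k) e)) ⟩
      ∑[ k < m ] (1ℤ * (coordinates β z k * chain (element β k) e) + -1ℤ * (c k * chain (element β k) e))
        ≡⟨ sum-linear 1ℤ -1ℤ (λ k → coordinates β z k * chain (element β k) e)
                             (λ k → c k * chain (element β k) e) ⟩
      1ℤ * combination (coordinates β z) (chain ∘ element β) e + -1ℤ * combination c (chain ∘ element β) e
        ≡⟨ cong₂ (λ x y → 1ℤ * x + -1ℤ * y) (proj₂ (spanning β z) e) (z≗c e) ⟨
      1ℤ * chain z e + -1ℤ * chain z e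
        ≡⟨ cancel (chain z e) ⟩
      0ℤ ∎

  coordinates-combination : ∀ {r} z c (x : Fin r → Z₁ G) → chain z ≗ combination c (chain ∘ x) →
    coordinates β z ≗ (λ i j → coordinates β (x j) i) *ᵥ c
  coordinates-combination z c x z≗cx i = trans
    (coordinates-unique z (combination c K) (λ e → begin
      chain z e
        ≡⟨ z≗cx e ⟩
      combination c (chain ∘ x) e
        ≡⟨ sum-cong-≗ (λ j → cong (c j *_) (proj₂ (spanning β (x j)) e)) ⟩
      combination c (K ⊗ (chain ∘ element β)) e
        -- `combination c` is multiplication from the left by `c`, read as a matrix with a single
        -- row.
        ≡⟨ ⊗-assoc {l = 1} (λ _ → c) K (chain ∘ element β) zero e ⟨
      combination (combination c K) (chain ∘ element β) e ∎) i)
    (sum-cong-≗ λ j → *-comm (c j) (K j i))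
    where
    K : Matrix _ m
    K j i = coordinates β (x j) i

module _ {G : Graph} where

  changeOfBasis : ∀ {m n} → Basis G m → Basis G n → Matrix n m
  changeOfBasis β β′ i j = coordinates β′ (element β j) i

  changeOfBasis-coordinates : ∀ {m n} (β : Basis G m) (β′ : Basis G n) z →
    coordinates β′ z ≗ changeOfBasis β β′ *ᵥ coordinates β z
  changeOfBasis-coordinates β β′ z =
    coordinates-combination β′ z (coordinates β z) (element β) (proj₂ (spanning β z))

  -- Passing from `β′` back to `β` is applied to `element β j`, whose coordinates in `β` are the
  -- unit vector at `j`.
  changeOfBasis-inverse : ∀ {m n} (β : Basis G m) (β′ : Basis G n) →
    changeOfBasis β′ β ⊗ changeOfBasis β β′ ≋ δ
  changeOfBasis-inverse β β′ i j = trans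
    (sym (changeOfBasis-coordinates β′ β (element β j) i))
    (coordinates-unique β (element β j) (λ k → δ k j) (λ e → sym (trans
      (sum-cong-≗ λ k → *-comm (δ k j) (chain (element β k) e))
      (sum-δʳ (λ k → chain (element β k) e) j))) i)

  -- winding G 𝒜 β z and det (windingMatrix 𝒜 β z) are definitionally equal.
  windingMatrix : (𝒜 : Unicyclization G) → let n = suc (Unicyclization.#cols 𝒜) in
    Basis G n → Z₁ G → Matrix n n
  windingMatrix 𝒜 β z i zero    = coordinates β z i
  windingMatrix 𝒜 β z i (suc j) = coordinates β (Unicyclization.∂-column 𝒜 j) i

  -- The cycle fills just the first column, along which `det` expands; the minors do not contain it,
  -- so they are the same for `z` and `z′`.
  winding-scale : ∀ 𝒜 β {z z′} c → (∀ e → chain z′ e ≡ c * chain z e) →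
    winding G 𝒜 β z′ ≡ c * winding G 𝒜 β z
  winding-scale 𝒜 β {z} {z′} c z′≗cz = trans
    (sum-cong-≗ λ i → trans (cong (λ x → (-1ℤ ^ toℕ i) * x * minors i) (scaled i))
                            (rearrange (-1ℤ ^ toℕ i) (coordinates β z i) (minors i)))
    (sym (*-distribˡ-sum c (λ i → (-1ℤ ^ toℕ i) * coordinates β z i * minors i)))
    where
    minors : Fin (suc (Unicyclization.#cols 𝒜)) → ℤ
    minors i = det (minor i (windingMatrix 𝒜 β z))
    rearrange : ∀ g a d → g * (c * a) * d ≡ c * (g * a * d)
    rearrange = solved c
      where
      solved : ∀ c g a d → g * (c * a) * d ≡ c * (g * a * d)
      solved = solve-∀
    scaled : ∀ i → coordinates β z′ i ≡ c * coordinates β z i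
    scaled = coordinates-unique β z′ (λ i → c * coordinates β z i) λ e → begin
      chain z′ e  ≡⟨ z′≗cz e ⟩
      c * chain z e ≡⟨ cong (c *_) (proj₂ (spanning β z) e) ⟩
      c * combination (coordinates β z) (chain ∘ element β) e
        ≡⟨ *-distribˡ-sum c (λ i → coordinates β z i * chain (element β i) e) ⟩
      sum (λ i → c * (coordinates β z i * chain (element β i) e))
        ≡⟨ sum-cong-≗ (λ i → *-assoc c (coordinates β z i) (chain (element β i) e)) ⟨
      combination (λ i → c * coordinates β z i) (chain ∘ element β) e ∎

  winding-unique : ∀ 𝒜 𝒜′ → SameImage (Unicyclization.∂ 𝒜) (Unicyclization.∂ 𝒜′) → ∀ β β′ →
    ∃ λ s → IsUnit s × (∀ z → winding G 𝒜 β z ≡ s * winding G 𝒜′ β′ z)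
  winding-unique 𝒜 𝒜′ same β β′ =
    let s , unit , det≡ = det-sandwich P (changeOfBasis β β′) (1⊕ Q) (1⊕ R)
          (changeOfBasis-inverse β β′) (changeOfBasis-inverse β′ β) (1⊕-⊗-inverse Q R QR≋δ)
    in s , unit , λ z → det≡ (windingMatrix 𝒜 β z) (windingMatrix 𝒜′ β′ z) (factor z)
    where
    module 𝒜 = Unicyclization 𝒜
    module 𝒜′ = Unicyclization 𝒜′
    P : Matrix (suc 𝒜.#cols) (suc 𝒜′.#cols)
    P = changeOfBasis β′ β
    Q×R : ∃ λ Q → ∃ λ R → 𝒜.∂ ≋ 𝒜′.∂ ⊗ Q × Q ⊗ R ≋ δ
    Q×R = same-image⇒invertible 𝒜′.∂ 𝒜.∂ 𝒜′.ker-trivial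
            (λ y → Equivalence.from (same y)) (λ y → Equivalence.to (same y))
    Q : Matrix 𝒜′.#cols 𝒜.#cols
    Q = proj₁ Q×R
    R : Matrix 𝒜.#cols 𝒜′.#cols
    R = proj₁ (proj₂ Q×R)
    QR≋δ : Q ⊗ R ≋ δ
    QR≋δ = proj₂ (proj₂ (proj₂ Q×R))
    factor : ∀ z → windingMatrix 𝒜 β z ≋ P ⊗ windingMatrix 𝒜′ β′ z ⊗ (1⊕ Q)
    factor z i zero = begin
      coordinates β z i              ≡⟨ changeOfBasis-coordinates β′ β z i ⟩
      -- The first column of `1⊕ Q` is a unit vector, so it picks out the first column of `PM`.
      (P *ᵥ coordinates β′ z) i      ≡⟨ trans (cong₂ _+_ (*-identityʳ (PM i zero))
                                          (sum-zero λ j → *-zeroʳ (PM i (suc j)))) (+-identityʳ (PM i zero)) ⟨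
      (PM ⊗ (1⊕ Q)) i zero           ∎
      where
      PM : Matrix (suc 𝒜.#cols) (suc 𝒜′.#cols)
      PM = P ⊗ windingMatrix 𝒜′ β′ z
    factor z i (suc j) = begin
      coordinates β (𝒜.∂-column j) i
        -- Column `j` of `∂` is the combination of the columns of `∂′` with the coefficients of
        -- column `j` of `Q`; coordinates preserve this relation.
        ≡⟨ coordinates-combination β (𝒜.∂-column j) (λ h → Q h j) 𝒜′.∂-column (λ e → trans
             (proj₁ (proj₂ (proj₂ Q×R)) e j) (sum-cong-≗ λ h → *-comm (𝒜′.∂ e h) (Q h j))) i ⟩
      ∑[ h < 𝒜′.#cols ] (coordinates β (𝒜′.∂-column h) i * Q h j)
        ≡⟨ sum-cong-≗ (λ h → cong (_* Q h j) (changeOfBasis-coordinates β′ β (𝒜′.∂-column h) i)) ⟩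
      ∑[ h < 𝒜′.#cols ] (PM i (suc h) * Q h j)
        ≡⟨ trans (cong (_+ tail) (*-zeroʳ (PM i zero))) (+-identityˡ tail) ⟨
      (PM ⊗ (1⊕ Q)) i (suc j) ∎
      where
      PM : Matrix (suc 𝒜.#cols) (suc 𝒜′.#cols)
      PM = P ⊗ windingMatrix 𝒜′ β′ z
      tail : ℤ
      tail = ∑[ h < 𝒜′.#cols ] (PM i (suc h) * Q h j)

-- Cycle vectors

module _ {n} (y : Vector ℤ n) where

  -- Rewrites a chain supported on the edges of a traversal as a sum along the list, so that
  -- boundaries can be computed by recursion on the traversal.
  restrict : List (Fin n) → Vector ℤ n
  restrict []       e = 0ℤ
  restrict (f ∷ es) e = y f * δ f e + restrict es e

  restrict-∉ : ∀ es {e} → e ∉ es → restrict es e ≡ 0ℤ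
  restrict-∉ []       e∉ = refl
  restrict-∉ (f ∷ es) {e} e∉ = cong₂ _+_
    (trans (cong (y f *_) (δ-≢ λ f≡e → e∉ (here (sym f≡e)))) (*-zeroʳ (y f)))
    (restrict-∉ es (e∉ ∘ there))

  restrict-∈ : ∀ {es e} → Unique es → e ∈ es → restrict es e ≡ y e
  restrict-∈ {f ∷ es} (f∉ ∷ _) (here refl) = begin
    y f * δ f f + restrict es f  ≡⟨ cong₂ (λ x r → y f * x + r) (δ-refl f)
                                      (restrict-∉ es λ f∈ → All.lookup f∉ f∈ refl) ⟩
    y f * 1ℤ + 0ℤ                ≡⟨ trans (+-identityʳ _) (*-identityʳ (y f)) ⟩
    y f                          ∎
  restrict-∈ {f ∷ es} {e} (f∉ ∷ unique) (there e∈) = begin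
    y f * δ f e + restrict es e  ≡⟨ cong₂ (λ x r → y f * x + r) (δ-≢ (All.lookup f∉ e∈)) (restrict-∈ unique e∈) ⟩
    y f * 0ℤ + y e               ≡⟨ trans (cong (_+ y e) (*-zeroʳ (y f))) (+-identityˡ (y e)) ⟩
    y e                          ∎

  restrict-supported : ∀ {es} → Unique es → (∀ e → e ∉ es → y e ≡ 0ℤ) → restrict es ≗ y
  restrict-supported {es} unique supported e with _∈?_ _≟_ e es
  ... | yes e∈ = restrict-∈ unique e∈
  ... | no  e∉ = trans (restrict-∉ es e∉) (sym (supported e e∉))

module _ {n} (g y : Vector ℤ n) where

  -- With `g` a row of `∂₁`, this is the boundary at one vertex, collected along the list.
  weighted : List (Fin n) → ℤ
  weighted []       = 0ℤ
  weighted (f ∷ es) = y f * g f + weighted es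

  sum-restrict : ∀ es → ∑[ e < n ] (g e * restrict y es e) ≡ weighted es
  sum-restrict []       = sum-zero λ e → *-zeroʳ (g e)
  sum-restrict (f ∷ es) = begin
    ∑[ e < n ] (g e * (y f * δ f e + restrict y es e))
      ≡⟨ sum-cong-≗ (λ e → rearrange (g e) (y f) (δ f e) (restrict y es e)) ⟩
    ∑[ e < n ] (y f * (δ f e * g e) + 1ℤ * (g e * restrict y es e))
      ≡⟨ sum-linear (y f) 1ℤ (λ e → δ f e * g e) (λ e → g e * restrict y es e) ⟩
    y f * sum (λ e → δ f e * g e) + 1ℤ * sum (λ e → g e * restrict y es e)
      ≡⟨ cong₂ (λ a b → y f * a + b) (sum-δˡ f g) (trans (*-identityˡ _) (sum-restrict es)) ⟩
    y f * g f + weighted es ∎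
    where
    rearrange : ∀ g y d r → g * (y * d + r) ≡ y * (d * g) + 1ℤ * (g * r)
    rearrange = solve-∀

◃1-square : ∀ s → (s ◃ 1) * (s ◃ 1) ≡ 1ℤ
◃1-square Sign.+ = refl
◃1-square Sign.- = refl

module _ {G : Graph} where
  open Graph G

  support⁻ : ∀ ds {e} → e ∈ˢ support G ds → e ∈ map (edge G) ds
  support⁻ []       e∈ = contradiction e∈ ∉⊥
  support⁻ (d ∷ ds) e∈ with x∈p∪q⁻ _ (support G ds) e∈
  ... | inj₁ p = here (x∈⁅y⁆⇒x≡y (edge G d) p)
  ... | inj₂ q = there (support⁻ ds q)

  support⁺ : ∀ ds {e} → e ∈ map (edge G) ds → e ∈ˢ support G ds
  support⁺ (d ∷ ds) (here refl) = x∈p∪q⁺ (inj₁ (x∈⁅x⁆ (edge G d)))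
  support⁺ (d ∷ ds) (there e∈)  = x∈p∪q⁺ (inj₂ (support⁺ ds e∈))

  traversalVector-∉ : ∀ ds {e} → e ∉ map (edge G) ds → traversalVector G ds e ≡ 0ℤ
  traversalVector-∉ []       e∉ = refl
  traversalVector-∉ ((f , s) ∷ ds) e∉ = cong₂ _+_
    (trans (cong ((s ◃ 1) *_) (δ-≢ λ f≡e → e∉ (here (sym f≡e)))) (*-zeroʳ (s ◃ 1)))
    (traversalVector-∉ ds (e∉ ∘ there))

  module _ (y : Vector ℤ #E) where

    flow : Dart G → ℤ
    flow (e , s) = (s ◃ 1) * y e

    -- Net inflow at `v`: each dart delivers its flow at its end and draws it at its start.
    excess : List (Dart G) → Vector ℤ #V
    excess []       v = 0ℤ
    excess (d ∷ ds) v = flow d * (δ (end G d) v - δ (start G d) v) + excess ds v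

    -- Changes of flow from each dart to the next, located at the vertex between them; `x` is the
    -- flow through the preceding dart.
    jumps : ℤ → List (Dart G) → Vector ℤ #V
    jumps x []       v = 0ℤ
    jumps x (d ∷ ds) v = (flow d - x) * δ (start G d) v + jumps (flow d) ds v

    weighted≡excess : ∀ v ds → weighted (∂₁ G v) y (map (edge G) ds) ≡ excess ds v
    weighted≡excess v []                  = refl
    weighted≡excess v ((e , Sign.+) ∷ ds) = cong₂ _+_
      (cong (_* ∂₁ G v e) (sym (*-identityˡ (y e)))) (weighted≡excess v ds)
    weighted≡excess v ((e , Sign.-) ∷ ds) = cong₂ _+_
      (reverse (y e) (δ (tgt e) v) (δ (src e) v)) (weighted≡excess v ds)
      where
      reverse : ∀ y a b → y * (a - b) ≡ (-1ℤ * y) * (b - a)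
      reverse = solve-∀

    -- Summation by parts: the end of each dart is the start of the next one.
    excess+jumps : ∀ d ds d₀ → Linked (λ x y → end G x ≡ start G y) (d ∷ ds ++ [ d₀ ]) →
      ∀ v → start G d₀ ≢ v → excess (d ∷ ds) v + jumps (flow d) ds v ≡ - (flow d * δ (start G d) v)
    excess+jumps d [] d₀ (end≡start ∷ _) v ≢v = begin
      flow d * (δ (end G d) v - δ (start G d) v) + 0ℤ + 0ℤ
        -- The last dart ends where `d₀` starts, at the closing vertex, which `v` avoids.
        ≡⟨ cong (λ x → flow d * (x - δ (start G d) v) + 0ℤ + 0ℤ)
                (trans (cong (λ u → δ u v) end≡start) (δ-≢ ≢v)) ⟩
      flow d * (0ℤ - δ (start G d) v) + 0ℤ + 0ℤ
        ≡⟨ simplify (flow d) (δ (start G d) v) ⟩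
      - (flow d * δ (start G d) v) ∎
      where
      simplify : ∀ a b → a * (0ℤ - b) + 0ℤ + 0ℤ ≡ - (a * b)
      simplify = solve-∀
    excess+jumps d (d′ ∷ ds) d₀ (end≡start ∷ linked) v ≢v = begin
      flow d * (δ (end G d) v - b) + E + ((flow d′ - flow d) * b′ + J)
        ≡⟨ cong (λ x → flow d * (δ x v - b) + E + ((flow d′ - flow d) * b′ + J)) end≡start ⟩
      flow d * (b′ - b) + E + ((flow d′ - flow d) * b′ + J)
        ≡⟨ regroup (flow d) (flow d′) b b′ E J ⟩
      (E + J) + (flow d′ * b′ - flow d * b)
        ≡⟨ cong (_+ (flow d′ * b′ - flow d * b)) (excess+jumps d′ ds d₀ linked v ≢v) ⟩
      - (flow d′ * b′) + (flow d′ * b′ - flow d * b)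
        ≡⟨ cancel (flow d′ * b′) (flow d * b) ⟩
      - (flow d * b) ∎
      where
      b b′ E J : ℤ
      b  = δ (start G d) v
      b′ = δ (start G d′) v
      E  = excess (d′ ∷ ds) v
      J  = jumps (flow d′) ds v
      regroup : ∀ a a′ b b′ E J → a * (b′ - b) + E + ((a′ - a) * b′ + J) ≡ (E + J) + (a′ * b′ - a * b)
      regroup = solve-∀
      cancel : ∀ p q → - p + (p - q) ≡ - q
      cancel = solve-∀

    jumps-off : ∀ x ds {v} → All (v ≢_) (map (start G) ds) → jumps x ds v ≡ 0ℤ
    jumps-off x []       []         = refl
    jumps-off x (d ∷ ds) (v≢ ∷ off) = cong₂ _+_
      (trans (cong ((flow d - x) *_) (δ-≢ (≢-sym v≢))) (*-zeroʳ (flow d - x))) (jumps-off (flow d) ds off)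

    -- The starts are distinct, so at the start of the first dart only the jump into that dart is
    -- visible and must be 0; it then drops out at all other vertices, and the tail satisfies the
    -- same assumption.
    no-jumps⇒constant : ∀ x ds v₀ → Unique (map (start G) ds) → All (v₀ ≢_) (map (start G) ds) →
      (∀ v → v₀ ≢ v → jumps x ds v ≡ 0ℤ) → All (λ d → flow d ≡ x) ds
    no-jumps⇒constant x []       v₀ _                _          _    = []
    no-jumps⇒constant x (d ∷ ds) v₀ (d∉ ∷ unique) (v₀≢ ∷ avoid) zeros =
      flow≡x ∷ All.map (λ p → trans p flow≡x) (no-jumps⇒constant (flow d) ds v₀ unique avoid λ v v₀≢v → begin
        jumps (flow d) ds v                                ≡⟨ +-identityˡ _ ⟨
        0ℤ * δ (start G d) v + jumps (flow d) ds v
          ≡⟨ cong (λ a → a * δ (start G d) v + jumps (flow d) ds v) jump≡0 ⟨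
        (flow d - x) * δ (start G d) v + jumps (flow d) ds v ≡⟨ zeros v v₀≢v ⟩
        0ℤ ∎)
      where
      jump≡0 : flow d - x ≡ 0ℤ
      jump≡0 = begin
        flow d - x                     ≡⟨ trans (+-identityʳ _) (*-identityʳ (flow d - x)) ⟨
        (flow d - x) * 1ℤ + 0ℤ         ≡⟨ cong₂ (λ a b → (flow d - x) * a + b) (δ-refl (start G d))
                                            (jumps-off (flow d) ds d∉) ⟨
        jumps x (d ∷ ds) (start G d)   ≡⟨ zeros (start G d) v₀≢ ⟩
        0ℤ                             ∎
      flow≡x : flow d ≡ x
      flow≡x = i-j≡0⇒i≡j (flow d) x jump≡0

    constant-flow : ∀ c ds → All (λ d → flow d ≡ c) ds →
                    ∀ e → restrict y (map (edge G) ds) e ≡ c * traversalVector G ds e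
    constant-flow c []             []           e = sym (*-zeroʳ c)
    constant-flow c ((f , s) ∷ ds) (flow≡c ∷ p) e = begin
      y f * δ f e + restrict y (map (edge G) ds) e
        ≡⟨ cong₂ (λ x r → x * δ f e + r) yf≡ (constant-flow c ds p e) ⟩
      c * (s ◃ 1) * δ f e + c * traversalVector G ds e
        ≡⟨ factor c (s ◃ 1) (δ f e) (traversalVector G ds e) ⟩
      c * ((s ◃ 1) * δ f e + traversalVector G ds e) ∎
      where
      factor : ∀ c s d t → c * s * d + c * t ≡ c * (s * d + t)
      factor = solve-∀
      undo : ∀ s y → s * s * y ≡ s * y * s
      undo = solve-∀
      yf≡ : y f ≡ c * (s ◃ 1)
      yf≡ = begin
        y f                          ≡⟨ *-identityˡ (y f) ⟨
        1ℤ * y f                     ≡⟨ cong (_* y f) (◃1-square s) ⟨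
        (s ◃ 1) * (s ◃ 1) * y f      ≡⟨ undo (s ◃ 1) (y f) ⟩
        (s ◃ 1) * y f * (s ◃ 1)      ≡⟨ cong (_* (s ◃ 1)) flow≡c ⟩
        c * (s ◃ 1)                  ∎

  -- Kirchhoff's law: at a vertex other than the base point nothing accumulates, so the flow cannot
  -- change there. The factor is the flow through the first dart; the base point may be left out
  -- because `jumps` does not record the return from the last dart to the first.
  closed⇒multiple : ∀ (y : Z₁ G) ds → IsTraversal G ds → (∀ e → e ∉ map (edge G) ds → chain y e ≡ 0ℤ) →
                    ∃ λ c → ∀ e → chain y e ≡ c * traversalVector G ds e
  closed⇒multiple y (d ∷ ds) (linked , d∉ ∷ starts , edges) supported = flow (chain y) d , λ e → begin
    chain y e                                          ≡⟨ restricted e ⟨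
    restrict (chain y) (map (edge G) (d ∷ ds)) e
      ≡⟨ constant-flow (chain y) (flow (chain y) d) (d ∷ ds) constant e ⟩
    flow (chain y) d * traversalVector G (d ∷ ds) e    ∎
    where
    restricted : restrict (chain y) (map (edge G) (d ∷ ds)) ≗ chain y
    restricted = restrict-supported (chain y) edges supported
    excess≡0 : ∀ v → excess (chain y) (d ∷ ds) v ≡ 0ℤ
    excess≡0 v = begin
      excess (chain y) (d ∷ ds) v                            ≡⟨ weighted≡excess (chain y) v (d ∷ ds) ⟨
      weighted (∂₁ G v) (chain y) (map (edge G) (d ∷ ds))
        ≡⟨ sum-restrict (∂₁ G v) (chain y) (map (edge G) (d ∷ ds)) ⟨
      ∑[ e < #E ] (∂₁ G v e * restrict (chain y) (map (edge G) (d ∷ ds)) e)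
        ≡⟨ sum-cong-≗ (λ e → cong (∂₁ G v e *_) (restricted e)) ⟩
      (∂₁ G *ᵥ chain y) v                                    ≡⟨ closed y v ⟩
      0ℤ                                                     ∎
    jumps≡0 : ∀ v → start G d ≢ v → jumps (chain y) (flow (chain y) d) ds v ≡ 0ℤ
    jumps≡0 v ≢v = begin
      J                                          ≡⟨ +-identityˡ J ⟨
      0ℤ + J                                     ≡⟨ cong (_+ J) (excess≡0 v) ⟨
      excess (chain y) (d ∷ ds) v + J            ≡⟨ excess+jumps (chain y) d ds d linked v ≢v ⟩
      - (flow (chain y) d * δ (start G d) v)     ≡⟨ cong (λ x → - (flow (chain y) d * x)) (δ-≢ ≢v) ⟩
      - (flow (chain y) d * 0ℤ)                  ≡⟨ cong -_ (*-zeroʳ (flow (chain y) d)) ⟩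
      0ℤ                                         ∎
      where
      J : ℤ
      J = jumps (chain y) (flow (chain y) d) ds v
    constant : All (λ d′ → flow (chain y) d′ ≡ flow (chain y) d) (d ∷ ds)
    constant = refl ∷ no-jumps⇒constant (chain y) _ ds (start G d) starts d∉ jumps≡0

  -- From the traversal behind `y` only its edge set is used: the shared support places `y` on the
  -- edges of the traversal behind `z`.
  cycleVector-multiple : ∀ {C} {y z : Z₁ G} → IsCycleVector G C (chain y) → IsCycleVector G C (chain z) →
                         ∃ λ c → ∀ e → chain y e ≡ c * chain z e
  cycleVector-multiple {y = y} (ds , _ , supp , y≗) (ds′ , trav′ , supp′ , z≗) =
    let c , y≡ = closed⇒multiple y ds′ trav′ λ e e∉ → trans (y≗ e)
          (traversalVector-∉ ds λ e∈ → e∉ (support⁻ ds′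
             (subst (e ∈ˢ_) (trans supp (sym supp′)) (support⁺ ds e∈))))
    in c , λ e → trans (y≡ e) (cong (c *_) (sym (z≗ e)))

  -- The first edge of the traversal does not recur, so its entry is a single sign. A nonzero entry
  -- is what allows proportionality factors to be compared.
  cycleVector-entry : ∀ {C z} → IsCycleVector G C z → ∃ λ e → z e * z e ≡ 1ℤ
  cycleVector-entry ((f , s) ∷ ds , (_ , _ , f∉ ∷ _) , _ , z≗) = f ,
    trans (cong₂ _*_ z≡s z≡s) (◃1-square s)
    where
    z≡s : _ ≡ s ◃ 1
    z≡s = begin
      _                                             ≡⟨ z≗ f ⟩
      (s ◃ 1) * δ f f + traversalVector G ds f      ≡⟨ cong₂ (λ x t → (s ◃ 1) * x + t) (δ-refl f)
                                                         (traversalVector-∉ ds λ f∈ → All.lookup f∉ f∈ refl) ⟩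
      (s ◃ 1) * 1ℤ + 0ℤ                             ≡⟨ trans (+-identityʳ _) (*-identityʳ (s ◃ 1)) ⟩
      s ◃ 1                                         ∎

  -- Going from `z` to `y` and back multiplies an entry ±1 by `c * c′` without changing it, so `c`
  -- is a unit of ℤ.
  cycleVector-unique : ∀ {C} {y z : Z₁ G} → IsCycleVector G C (chain y) → IsCycleVector G C (chain z) →
                       ∃ λ c → c * c ≡ 1ℤ × (∀ e → chain y e ≡ c * chain z e)
  cycleVector-unique {y = y} {z} y-cycle z-cycle with cycleVector-multiple {y = y} {z} y-cycle z-cycle
                                   | cycleVector-multiple {y = z} {y} z-cycle y-cycle
                                   | cycleVector-entry z-cycle
  ... | c , y≡cz | c′ , z≡c′y | e , ze²≡1 = c , unit-square (i*j≡1⇒unit c c′ cc′≡1) , y≡cz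
    where
    x : ℤ
    x = chain z e
    unit-square : ∀ {i} → IsUnit i → i * i ≡ 1ℤ
    unit-square (inj₁ refl) = refl
    unit-square (inj₂ refl) = refl
    regroup : ∀ c c′ x → c * c′ * (x * x) ≡ c′ * (c * x) * x
    regroup = solve-∀
    cc′≡1 : c * c′ ≡ 1ℤ
    cc′≡1 = begin
      c * c′                ≡⟨ *-identityʳ (c * c′) ⟨
      c * c′ * 1ℤ           ≡⟨ cong (c * c′ *_) ze²≡1 ⟨
      c * c′ * (x * x)      ≡⟨ regroup c c′ x ⟩
      c′ * (c * x) * x      ≡⟨ cong (λ w → c′ * w * x) (y≡cz e) ⟨
      c′ * chain y e * x    ≡⟨ cong (_* x) (z≡c′y e) ⟨
      x * x                 ≡⟨ ze²≡1 ⟩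
      1ℤ                    ∎

  -- The harmonic cycle

  quadratic-scale : ∀ s c {w w′ x x′} → c * c ≡ 1ℤ → w ≡ s * (c * w′) → x ≡ c * x′ → w * x ≡ s * (w′ * x′)
  quadratic-scale s c {w′ = w′} {x′ = x′} c²≡1 refl refl = begin
    s * (c * w′) * (c * x′)    ≡⟨ regroup s c w′ x′ ⟩
    s * (w′ * x′) * (c * c)    ≡⟨ cong (s * (w′ * x′) *_) c²≡1 ⟩
    s * (w′ * x′) * 1ℤ         ≡⟨ *-identityʳ _ ⟩
    s * (w′ * x′)              ∎
    where
    regroup : ∀ s c w x → s * (c * w) * (c * x) ≡ s * (w * x) * (c * c)
    regroup = solve-∀

  foldr-scale : ∀ {A : Set} s (f g : A → ℤ) {xs} → All (λ x → f x ≡ s * g x) xs →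
    foldr (λ x acc → f x + acc) 0ℤ xs ≡ s * foldr (λ x acc → g x + acc) 0ℤ xs
  foldr-scale s f g []       = sym (*-zeroʳ s)
  foldr-scale s f g {x ∷ xs} (p ∷ ps) = trans (cong₂ _+_ p (foldr-scale s f g ps))
                                              (sym (*-distribˡ-+ s (g x) _))

  harmonicCycle-scale : ∀ 𝒜 𝒜′ β β′ s → (∀ z → winding G 𝒜 β z ≡ s * winding G 𝒜′ β′ z) →
    ∀ o o′ e → harmonicCycle G 𝒜 β o e ≡ s * harmonicCycle G 𝒜′ β′ o′ e
  harmonicCycle-scale 𝒜 𝒜′ β β′ s w≡sw′ o o′ e =
    -- Both sums run over the same list; `all-filter` recovers for each entry the proof of being a
    -- cycletree that `z-cycle` asks for.
    foldr-scale s summand summand′ (All.map term≡ (all-filter (isCycletree? G) (subsets #E)))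
    where
    open CycleChoice
    summand summand′ : Subset #E → ℤ
    summand  Y = winding G 𝒜 β (z o Y) * chain (z o Y) e
    summand′ Y = winding G 𝒜′ β′ (z o′ Y) * chain (z o′ Y) e
    term≡ : ∀ {Y} → IsCycletree G Y → summand Y ≡ s * summand′ Y
    term≡ {Y} y =
      -- The same proof `y` is given to both choices, so both vectors belong to one cycle. The
      -- factor `c` enters twice, through the winding number and through the vector, and cancels as
      -- `c * c`.
      let c , c²≡1 , z≡cz′ = cycleVector-unique {y = z o Y} {z o′ Y} (z-cycle o Y y) (z-cycle o′ Y y)
      in quadratic-scale s c {w′ = winding G 𝒜′ β′ (z o′ Y)} c²≡1
           (trans (w≡sw′ (z o Y)) (cong (s *_) (winding-scale 𝒜′ β′ {z o′ Y} {z o Y} c z≡cz′))) (z≡cz′ e)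

up-to-sign : ∀ {A : Set} {f g : A → ℤ} {s} → IsUnit s → (∀ x → f x ≡ s * g x) →
             (∀ x → f x ≡ g x) ⊎ (∀ x → f x ≡ - g x)
up-to-sign {g = g} (inj₁ refl) f≡sg = inj₁ λ x → trans (f≡sg x) (*-identityˡ (g x))
up-to-sign {g = g} (inj₂ refl) f≡sg = inj₂ λ x → trans (f≡sg x) (-1*i≡-i (g x))

corollary4p4p1 : (G : Graph) → Connected G →
    (𝒜 𝒜′ : Unicyclization G) →
    SameImage (Unicyclization.∂ 𝒜) (Unicyclization.∂ 𝒜′) →
    (β  : Basis G (suc (Unicyclization.#cols 𝒜))) →
    (β′ : Basis G (suc (Unicyclization.#cols 𝒜′))) →
    (o o′ : CycleChoice G) →
    ((∀ z → winding G 𝒜 β z ≡ winding G 𝒜′ β′ z)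
    ⊎ (∀ z → winding G 𝒜 β z ≡ - winding G 𝒜′ β′ z))
    × ((∀ e → harmonicCycle G 𝒜 β o e ≡ harmonicCycle G 𝒜′ β′ o′ e)
    ⊎ (∀ e → harmonicCycle G 𝒜 β o e ≡ - harmonicCycle G 𝒜′ β′ o′ e))
corollary4p4p1 G _ 𝒜 𝒜′ same β β′ o o′ =
  let s , unit , w≡sw′ = winding-unique 𝒜 𝒜′ same β β′
  in up-to-sign unit w≡sw′ , up-to-sign unit (harmonicCycle-scale 𝒜 𝒜′ β β′ s w≡sw′ o o′)
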